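{- With probability $1-O(n^{ -1/2})$, the random graph $G(n,1/2)$ contains no pair of (distinct) cospectral vertices.
   Context: $G(n,1/2)$ is the random graph on the vertex set $\{1,\ldots,n\}$ in which each pair of distinct vertices is adjacent with probability $1/2$ independently of the other pairs. Two graphs are cospectral if their adjacency matrices have the same characteristic polynomial. For a vertex $v$ of a graph $G$, $G\setminus v$ is the graph obtained from $G$ by removing $v$ along with all incident edges. Two vertices $x,y$ of a graph $G$ are cospectral if the graphs $G\setminus x$ and $G\setminus y$ are cospectral. The $O(\cdot)$ is as $n\to\infty$, with an absolute implied constant. -}

module Defs where

open import Algebra.Bundles.Raw using (RawRing)
import Algebra.Definitions.RawSemiring as RawSemiringDefinitions
open import Data.Bool using (Bool; true; false; if_then_else_)
open import Data.Fin using (Fin; zero; suc; toℕ; punchIn)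
open import Data.Fin.Properties using (any?) renaming (_≟_ to _≟ᶠ_)
open import Data.Integer using (ℤ; +_; 0ℤ; 1ℤ) renaming (_+_ to _+ℤ_; _*_ to _*ℤ_; -_ to -ℤ_; _≟_ to _≟ℤ_)
open import Data.List using (List; []; _∷_; map; concatMap; filter; foldr)
open import Data.Nat using (ℕ; zero; suc; pred; _≥_)
open import Data.Product using (_×_; _,_; proj₁; proj₂; ∃-syntax)
open import Data.Rational using (ℚ; 0ℚ; 1ℚ; ½; _+_; _*_; _≤_; _/_)
open import Data.Vec using (Vec; []; _∷_; lookup)
open import Level using (0ℓ)
open import Relation.Binary.PropositionalEquality using (_≡_; _≢_; refl)
open import Relation.Nullary using (Dec; yes; ¬_; does)
open import Relation.Nullary.Decidable using (map′; _×-dec_; ¬?)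
open import Relation.Unary using (Pred; Decidable)

module Determinant {c ℓ} (R : RawRing c ℓ) where
  open RawRing R using (Carrier; rawSemiring; 1#)
    renaming (_*_ to _*ᴿ_; -_ to -ᴿ_)
  open RawSemiringDefinitions rawSemiring using (sum; _^_)

  Matrix : ℕ → Set c
  Matrix n = Fin n → Fin n → Carrier

  -- Expansion along the first row.
  det : ∀ {n} → Matrix n → Carrier
  det {zero}  M = 1#
  det {suc n} M = sum λ j →
    ((-ᴿ 1#) ^ toℕ j) *ᴿ (M zero j *ᴿ det λ i k → M (suc i) (punchIn j k))

-- Coefficient lists, constant term first.  Trailing zeros are allowed, so
-- equality of polynomials is _≈ₚ_ and not _≡_.
Poly : Set
Poly = List ℤ

coeff : Poly → ℕ → ℤ
coeff []      k       = 0ℤ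
coeff (a ∷ p) zero    = a
coeff (a ∷ p) (suc k) = coeff p k

infix 4 _≈ₚ_ _≈ₚ?_

_≈ₚ_ : Poly → Poly → Set
p ≈ₚ q = ∀ k → coeff p k ≡ coeff q k

infixl 6 _+ₚ_
infixl 7 _*ₚ_
infix  8 -ₚ_

_+ₚ_ : Poly → Poly → Poly
[]      +ₚ q       = q
(a ∷ p) +ₚ []      = a ∷ p
(a ∷ p) +ₚ (b ∷ q) = (a +ℤ b) ∷ (p +ₚ q)

-ₚ_ : Poly → Poly
-ₚ p = map -ℤ_ p

_*ₚ_ : Poly → Poly → Poly
[]      *ₚ q = []
(a ∷ p) *ₚ q = map (a *ℤ_) q +ₚ (0ℤ ∷ (p *ₚ q))

constₚ : ℤ → Poly
constₚ a = a ∷ []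

X : Poly
X = 0ℤ ∷ 1ℤ ∷ []

polyRawRing : RawRing 0ℓ 0ℓ
polyRawRing = record
  { Carrier = Poly
  ; _≈_     = _≈ₚ_
  ; _+_     = _+ₚ_
  ; _*_     = _*ₚ_
  ; -_      = -ₚ_
  ; 0#      = []
  ; 1#      = constₚ 1ℤ
  }

_≈ₚ?_ : ∀ p q → Dec (p ≈ₚ q)
[] ≈ₚ? [] = yes λ _ → refl
[] ≈ₚ? (b ∷ q) = map′
  (λ { (e , es) zero → e ; (e , es) (suc k) → es k })
  (λ es → es zero , λ k → es (suc k))
  ((0ℤ ≟ℤ b) ×-dec ([] ≈ₚ? q))
(a ∷ p) ≈ₚ? [] = map′
  (λ { (e , es) zero → e ; (e , es) (suc k) → es k })
  (λ es → es zero , λ k → es (suc k))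
  ((a ≟ℤ 0ℤ) ×-dec (p ≈ₚ? []))
(a ∷ p) ≈ₚ? (b ∷ q) = map′
  (λ { (e , es) zero → e ; (e , es) (suc k) → es k })
  (λ es → es zero , λ k → es (suc k))
  ((a ≟ℤ b) ×-dec (p ≈ₚ? q))

-- det (X · I − M)
charPoly : ∀ {n} → (Fin n → Fin n → ℤ) → Poly
charPoly M = Determinant.det polyRawRing λ i j →
  (if does (i ≟ᶠ j) then X else []) +ₚ -ₚ constₚ (M i j)

record SimpleGraph (n : ℕ) : Set where
  field
    adj    : Fin n → Fin n → Bool
    sym    : ∀ i j → adj i j ≡ adj j i
    irrefl : ∀ i → adj i i ≡ false

open SimpleGraph using (adj)

adjacencyMatrix : ∀ {n} → SimpleGraph n → Fin n → Fin n → ℤ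
adjacencyMatrix G i j = if adj G i j then 1ℤ else 0ℤ

Cospectral : ∀ {m n} → SimpleGraph m → SimpleGraph n → Set
Cospectral G H = charPoly (adjacencyMatrix G) ≈ₚ charPoly (adjacencyMatrix H)

infixl 6 _∖_

-- The remaining vertices are renumbered in increasing order by punchIn v.
_∖_ : ∀ {n} → SimpleGraph n → Fin n → SimpleGraph (pred n)
_∖_ {suc n} G v = record
  { adj    = λ i j → adj G (punchIn v i) (punchIn v j)
  ; sym    = λ i j → SimpleGraph.sym G (punchIn v i) (punchIn v j)
  ; irrefl = λ i → SimpleGraph.irrefl G (punchIn v i)
  }

CospectralVertices : ∀ {n} → SimpleGraph n → Fin n → Fin n → Set
CospectralVertices G x y = Cospectral (G ∖ x) (G ∖ y)

NoCospectralPair : ∀ {n} → SimpleGraph n → Set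
NoCospectralPair G = ¬ (∃[ x ] ∃[ y ] x ≢ y × CospectralVertices G x y)

noCospectralPair? : ∀ {n} → Decidable (NoCospectralPair {n})
noCospectralPair? G = ¬? (any? λ x → any? λ y →
  ¬? (x ≟ᶠ y) ×-dec
  (charPoly (adjacencyMatrix (G ∖ x)) ≈ₚ? charPoly (adjacencyMatrix (G ∖ y))))

-- A finitely supported distribution: outcomes with their weights.  The same
-- outcome may be listed several times, in which case its weights add up.
Dist : Set → Set
Dist A = List (A × ℚ)

return : ∀ {A} → A → Dist A
return a = (a , 1ℚ) ∷ []

infixl 1 _>>=_

-- Weights multiply, so experiments whose choice does not depend on earlier
-- outcomes are independent.
_>>=_ : ∀ {A B} → Dist A → (A → Dist B) → Dist B
d >>= f = concatMap (λ (a , p) → map (λ (b , q) → b , p * q) (f a)) d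

Pr : ∀ {A} → Dist A → {P : Pred A 0ℓ} → Decidable P → ℚ
Pr d P? = foldr _+_ 0ℚ (map proj₂ (filter (λ ω → P? (proj₁ ω)) d))

fairCoin : Dist Bool
fairCoin = (true , ½) ∷ (false , ½) ∷ []

fairCoins : ∀ n → Dist (Vec Bool n)
fairCoins zero    = return []
fairCoins (suc n) = do
  b  ← fairCoin
  bs ← fairCoins n
  return (b ∷ bs)

-- One bit for each unordered pair of distinct elements of Fin n: the first
-- row holds the pairs {0 , j + 1} for j < n, the remaining rows the pairs
-- not containing 0.
data PairBits : ℕ → Set where
  []  : PairBits zero
  _∷_ : ∀ {n} → Vec Bool n → PairBits n → PairBits (suc n)

bit : ∀ {n} → PairBits n → Fin n → Fin n → Bool
bit (r ∷ rs) zero    zero    = false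
bit (r ∷ rs) zero    (suc j) = lookup r j
bit (r ∷ rs) (suc i) zero    = lookup r i
bit (r ∷ rs) (suc i) (suc j) = bit rs i j

bit-sym : ∀ {n} (bs : PairBits n) i j → bit bs i j ≡ bit bs j i
bit-sym (r ∷ rs) zero    zero    = refl
bit-sym (r ∷ rs) zero    (suc j) = refl
bit-sym (r ∷ rs) (suc i) zero    = refl
bit-sym (r ∷ rs) (suc i) (suc j) = bit-sym rs i j

bit-irrefl : ∀ {n} (bs : PairBits n) i → bit bs i i ≡ false
bit-irrefl (r ∷ rs) zero    = refl
bit-irrefl (r ∷ rs) (suc i) = bit-irrefl rs i

toGraph : ∀ {n} → PairBits n → SimpleGraph n
toGraph bs = record { adj = bit bs ; sym = bit-sym bs ; irrefl = bit-irrefl bs }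

fairPairBits : ∀ n → Dist (PairBits n)
fairPairBits zero    = return []
fairPairBits (suc n) = do
  r  ← fairCoins n
  rs ← fairPairBits n
  return (r ∷ rs)

G⟨_,½⟩ : ∀ n → Dist (SimpleGraph n)
G⟨ n ,½⟩ = do
  bs ← fairPairBits n
  return (toGraph bs)

-- f(n) = O(n^(−1/2)).  For C ≥ 0 the bound |f(n)| ≤ C n^(−1/2) is equivalent
-- to f(n)² n ≤ C², which avoids the irrational square root.
O[n^-½] : (ℕ → ℚ) → Set
O[n^-½] f = ∃[ C ] 0ℚ ≤ C × (∃[ N ] ∀ n → n ≥ N →
  (f n * f n) * (+ n / 1) ≤ C * C)

{-# OPTIONS --safe #-}

-- Everything is read modulo 2.  There the determinant of a symmetric matrix
-- only sees involutions, so φ(G) = det (X I + A) satisfies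
--   φ(G) = X φ(G ∖ v) + Σ_j a_vj φ(G ∖ v ∖ j).
-- For vertices x ≠ y let H = G ∖ x ∖ y, and let w be the sum of the
-- neighbourhoods of x and y in H.  Expanding φ(G ∖ x) along y and φ(G ∖ y)
-- along x, cospectrality gives Σ_i w_i φ(H ∖ i) = 0.  The identity
--   (X² I + A) d = X φ(H) 𝟏   for d_i = φ(H ∖ i)
-- shows that the w with w · d = 0 form an A-invariant subspace of 𝟏^⊥, so that
-- w · A^k 𝟏 = 0 for all k.  Since w is uniform and independent of H, this has
-- probability at most 2^(-K) plus the probability that 𝟏, A 𝟏, …, A^(K-1) 𝟏 are
-- dependent.  The latter is bounded by a union over all possible values of
-- these vectors, as prescribing A on k independent vectors leaves only a
-- fraction 2^(-kn + O(k²)) of the graphs.  With K = 3 log₂ n a union bound over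
-- the pairs {x , y} finishes the proof.

module Submission where

open import Defs
open import Algebra.Bundles using (CommutativeMonoid; CommutativeRing)
open import Algebra.Bundles.Raw using (RawRing)
import Algebra.Definitions.RawSemiring as RawSemiringDefinitions
open import Data.Bool using (Bool; true; false; _∧_; _xor_; not; if_then_else_)
open import Data.Bool.Properties
  using (xor-same; xor-comm; xor-assoc; xor-identityʳ; xor-annihilates-not; not-distribˡ-xor; ∧-distribˡ-xor; ∧-distribʳ-xor; ∧-comm; ∧-assoc; ∧-zeroʳ; ∧-identityʳ; xor-∧-commutativeRing)
  renaming (_≟_ to _≟ᵇ_)
open import Data.Empty using (⊥)
open import Data.Fin using (Fin; zero; suc; punchIn; punchOut; pinch; toℕ)
open import Data.Fin.Properties using (any?; punchIn-injective; punchInᵢ≢i; punchIn-punchOut) renaming (_≟_ to _≟ᶠ_)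
open import Data.Integer as ℤ using (ℤ; -[1+_]; ∣_∣; _⊖_; 0ℤ; 1ℤ) renaming (_+_ to _+ℤ_; _*_ to _*ℤ_; -_ to -ℤ_)
import Data.Integer.Properties as ℤₚ
open import Data.List using (List; []; _∷_; _++_; map; length; cartesianProductWith; allFin; tabulate)
open import Data.List.Properties using (length-tabulate)
open import Data.Nat hiding (_/_)
open import Data.Nat.Properties
open import Data.Nat.Tactic.RingSolver using (solve-∀)
open import Data.Product using (_×_; _,_; proj₁; proj₂; Σ; ∃-syntax)
open import Data.Rational using (ℚ; 0ℚ; 1ℚ; ½; _-_; -_; _/_; toℚᵘ; Positive)
  renaming (_+_ to _+ℚ_; _*_ to _*ℚ_; _≤_ to _≤ℚ_)
import Data.Rational.Properties as ℚ
import Data.Rational.Unnormalised as ℚᵘ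
import Data.Rational.Unnormalised.Properties as ℚᵘₚ
open import Data.Unit using (⊤; tt)
open import Data.Vec using (Vec; []; _∷_; zipWith; replicate; head; tail; insertAt; lookup)
open import Data.Vec.Properties
  using (≡-dec; zipWith-assoc; zipWith-comm; ∷-injectiveˡ; ∷-injectiveʳ; insertAt-lookup; insertAt-punchIn; lookup-zipWith)
open import Function using (_∘_; id; const; flip)
open import Level using (0ℓ)
open import Relation.Binary.PropositionalEquality
open import Relation.Nullary using (Dec; yes; no; ¬_; does; contradiction)
open import Relation.Nullary.Decidable using (_×-dec_; ¬?; dec-true; dec-false; decidable-stable)
open import Relation.Unary using (Pred; Decidable)

open import Algebra.Properties.CommutativeSemigroup +-commutativeSemigroup using () renaming (interchange to +-interchange)
open import Algebra.Properties.CommutativeSemigroup *-commutativeSemigroup using () renaming (x∙yz≈y∙xz to *-x∙yz≈y∙xz)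
open import Algebra.Properties.CommutativeSemigroup
  (CommutativeMonoid.commutativeSemigroup (CommutativeRing.+-commutativeMonoid xor-∧-commutativeRing))
  using () renaming (interchange to xor-interchange)
open import Algebra.Properties.CommutativeSemigroup
  (CommutativeMonoid.commutativeSemigroup ℚ.*-1-commutativeMonoid)
  using () renaming (interchange to *ℚ-interchange)
import Algebra.Properties.Semiring.Sum (CommutativeRing.semiring xor-∧-commutativeRing) as BoolSum

open SimpleGraph using (adj)

private variable
  A A′ A″ Φ Ψ : Set
  m n : ℕ

-- Finite sums and vectors over 𝔽₂

∑ : List A → (A → ℕ) → ℕ
∑ []       f = 0
∑ (x ∷ xs) f = f x + ∑ xs f

∑-cong : ∀ (xs : List A) {f g} → f ≗ g → ∑ xs f ≡ ∑ xs g
∑-cong []       e = refl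
∑-cong (x ∷ xs) e = cong₂ _+_ (e x) (∑-cong xs e)

∑-mono : ∀ (xs : List A) {f g} → (∀ x → f x ≤ g x) → ∑ xs f ≤ ∑ xs g
∑-mono []       h = z≤n
∑-mono (x ∷ xs) h = +-mono-≤ (h x) (∑-mono xs h)

∑-+ : ∀ (xs : List A) f g → ∑ xs (λ x → f x + g x) ≡ ∑ xs f + ∑ xs g
∑-+ []       f g = refl
∑-+ (x ∷ xs) f g = trans (cong (f x + g x +_) (∑-+ xs f g)) (+-interchange (f x) (g x) _ _)

∑-*ˡ : ∀ (xs : List A) c f → ∑ xs (λ x → c * f x) ≡ c * ∑ xs f
∑-*ˡ []       c f = sym (*-zeroʳ c)
∑-*ˡ (x ∷ xs) c f = trans (cong (c * f x +_) (∑-*ˡ xs c f)) (sym (*-distribˡ-+ c (f x) _))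

∑-const : ∀ (xs : List A) c → ∑ xs (const c) ≡ length xs * c
∑-const []       c = refl
∑-const (x ∷ xs) c = cong (c +_) (∑-const xs c)

∑-swap : ∀ (xs : List A) (ys : List A′) (f : A → A′ → ℕ) → ∑ xs (λ x → ∑ ys (f x)) ≡ ∑ ys (λ y → ∑ xs λ x → f x y)
∑-swap []       ys f = sym (trans (∑-const ys 0) (*-zeroʳ (length ys)))
∑-swap (x ∷ xs) ys f = trans (cong (∑ ys (f x) +_) (∑-swap xs ys f)) (sym (∑-+ ys (f x) _))

∑-++ : ∀ (xs ys : List A) f → ∑ (xs ++ ys) f ≡ ∑ xs f + ∑ ys f
∑-++ []       ys f = refl
∑-++ (x ∷ xs) ys f = trans (cong (f x +_) (∑-++ xs ys f)) (sym (+-assoc (f x) _ _))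

∑-map : ∀ (h : A → A′) xs f → ∑ (map h xs) f ≡ ∑ xs (f ∘ h)
∑-map h []       f = refl
∑-map h (x ∷ xs) f = cong (f (h x) +_) (∑-map h xs f)

∑-cartesianProductWith : ∀ (h : A → A′ → A″) xs ys f →
  ∑ (cartesianProductWith h xs ys) f ≡ ∑ xs λ x → ∑ ys λ y → f (h x y)
∑-cartesianProductWith h []       ys f = refl
∑-cartesianProductWith h (x ∷ xs) ys f = trans (∑-++ (map (h x) ys) _ f)
  (cong₂ _+_ (∑-map (h x) ys f) (∑-cartesianProductWith h xs ys f))

𝟙 : Dec Φ → ℕ
𝟙 d = if does d then 1 else 0

𝟙-mono : ∀ (d : Dec Φ) (e : Dec Ψ) → (Φ → Ψ) → 𝟙 d ≤ 𝟙 e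
𝟙-mono (no _)  _       f = z≤n
𝟙-mono (yes p) (yes _) f = ≤-refl
𝟙-mono (yes p) (no ¬q) f = contradiction (f p) ¬q

𝟙-cong : ∀ (d : Dec Φ) (e : Dec Ψ) → (Φ → Ψ) → (Ψ → Φ) → 𝟙 d ≡ 𝟙 e
𝟙-cong d e f g = ≤-antisym (𝟙-mono d e f) (𝟙-mono e d g)

𝟙-no : ∀ (d : Dec Φ) → ¬ Φ → 𝟙 d ≡ 0
𝟙-no (no _)  ¬p = refl
𝟙-no (yes p) ¬p = contradiction p ¬p

𝟙-×-≤ : ∀ (d : Dec Φ) (e : Dec Ψ) → 𝟙 (d ×-dec e) ≤ 𝟙 d * 𝟙 e
𝟙-×-≤ (no _)  e       = z≤n
𝟙-×-≤ (yes p) (no _)  = z≤n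
𝟙-×-≤ (yes p) (yes _) = ≤-refl

bools : List Bool
bools = true ∷ false ∷ []

-- Opaque, so that the lists are not enumerated during conversion checking.
opaque
  vecs : ∀ n → List (Vec Bool n)
  vecs zero    = [] ∷ []
  vecs (suc n) = cartesianProductWith _∷_ bools (vecs n)

  graphs : ∀ n → List (PairBits n)
  graphs zero    = [] ∷ []
  graphs (suc n) = cartesianProductWith _∷_ (vecs n) (graphs n)

  ∑-vecs-zero : ∀ f → ∑ (vecs zero) f ≡ f []
  ∑-vecs-zero f = +-identityʳ (f [])

  ∑-vecs-∷ : ∀ n f → ∑ (vecs (suc n)) f ≡ ∑ bools λ b → ∑ (vecs n) λ v → f (b ∷ v)
  ∑-vecs-∷ n f = ∑-cartesianProductWith _∷_ bools (vecs n) f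

  ∑-graphs-zero : ∀ f → ∑ (graphs zero) f ≡ f []
  ∑-graphs-zero f = +-identityʳ (f [])

  ∑-graphs-∷ : ∀ n f → ∑ (graphs (suc n)) f ≡ ∑ (vecs n) λ r → ∑ (graphs n) λ G → f (r ∷ G)
  ∑-graphs-∷ n f = ∑-cartesianProductWith _∷_ (vecs n) (graphs n) f

graphCount : ℕ → ℕ
graphCount zero    = 1
graphCount (suc n) = 2 ^ n * graphCount n

∑-vecs-suc : ∀ n f → ∑ (vecs (suc n)) f ≡ ∑ (vecs n) (f ∘ (true ∷_)) + ∑ (vecs n) (f ∘ (false ∷_))
∑-vecs-suc n f = trans (∑-vecs-∷ n f) (cong (∑ (vecs n) (f ∘ (true ∷_)) +_) (+-identityʳ _))

∑-vecs-const : ∀ n c → ∑ (vecs n) (const c) ≡ 2 ^ n * c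
∑-vecs-const zero    c = trans (∑-vecs-zero (const c)) (sym (*-identityˡ c))
∑-vecs-const (suc n) c = begin
  ∑ (vecs (suc n)) (const c)  ≡⟨ ∑-vecs-suc n (const c) ⟩
  s + s                       ≡⟨ cong₂ _+_ (∑-vecs-const n c) (∑-vecs-const n c) ⟩
  2 ^ n * c + 2 ^ n * c       ≡⟨ double (2 ^ n) c ⟩
  2 ^ suc n * c               ∎
  where
  open ≡-Reasoning
  s = ∑ (vecs n) (const c)
  double : ∀ a b → a * b + a * b ≡ 2 * a * b
  double = solve-∀

∑-graphs-const : ∀ n c → ∑ (graphs n) (const c) ≡ graphCount n * c
∑-graphs-const zero    c = trans (∑-graphs-zero (const c)) (sym (*-identityˡ c))
∑-graphs-const (suc n) c = begin
  ∑ (graphs (suc n)) (const c)                     ≡⟨ ∑-graphs-∷ n _ ⟩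
  ∑ (vecs n) (λ _ → ∑ (graphs n) (const c))       ≡⟨ ∑-vecs-const n _ ⟩
  2 ^ n * ∑ (graphs n) (const c)                   ≡⟨ cong (2 ^ n *_) (∑-graphs-const n c) ⟩
  2 ^ n * (graphCount n * c)                       ≡⟨ *-assoc (2 ^ n) _ c ⟨
  2 ^ n * graphCount n * c                         ∎
  where open ≡-Reasoning

infix 4 _≟ᵛ_
infixl 6 _⊕_
infix 7 _∙_

_⊕_ : Vec Bool n → Vec Bool n → Vec Bool n
_⊕_ = zipWith _xor_

𝟎 𝟏 : Vec Bool n
𝟎 = replicate _ false
𝟏 = replicate _ true

_∙_ : Vec Bool n → Vec Bool n → Bool
[]      ∙ []      = false
(a ∷ u) ∙ (b ∷ v) = (a ∧ b) xor u ∙ v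

addIf : Bool → Vec Bool n → Vec Bool n → Vec Bool n
addIf true  u v = u ⊕ v
addIf false u v = v

infixr 7 _·_

_·_ : PairBits n → Vec Bool n → Vec Bool n
[]       · []      = []
(r ∷ rs) · (b ∷ v) = r ∙ v ∷ addIf b r (rs · v)

_≟ᵛ_ : (u v : Vec Bool n) → Dec (u ≡ v)
_≟ᵛ_ = ≡-dec _≟ᵇ_

⊕-same : ∀ (u : Vec Bool n) → u ⊕ u ≡ 𝟎
⊕-same []      = refl
⊕-same (a ∷ u) = cong₂ _∷_ (xor-same a) (⊕-same u)

⊕-comm : ∀ (u v : Vec Bool n) → u ⊕ v ≡ v ⊕ u
⊕-comm = zipWith-comm xor-comm

⊕-assoc : ∀ (u v w : Vec Bool n) → (u ⊕ v) ⊕ w ≡ u ⊕ (v ⊕ w)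
⊕-assoc = zipWith-assoc xor-assoc

𝟎-⊕ : ∀ (u : Vec Bool n) → 𝟎 ⊕ u ≡ u
𝟎-⊕ []      = refl
𝟎-⊕ (a ∷ u) = cong (a ∷_) (𝟎-⊕ u)

⊕-cancel : ∀ (u v : Vec Bool n) → u ⊕ (u ⊕ v) ≡ v
⊕-cancel u v = trans (sym (⊕-assoc u u v)) (trans (cong (_⊕ v) (⊕-same u)) (𝟎-⊕ v))

⊕-interchange : ∀ (a b c d : Vec Bool n) → (a ⊕ b) ⊕ (c ⊕ d) ≡ (a ⊕ c) ⊕ (b ⊕ d)
⊕-interchange [] [] [] [] = refl
⊕-interchange (a ∷ as) (b ∷ bs) (c ∷ cs) (d ∷ ds) = cong₂ _∷_ (xor-interchange a b c d) (⊕-interchange as bs cs ds)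

∙-⊕ʳ : ∀ (u v w : Vec Bool n) → u ∙ (v ⊕ w) ≡ u ∙ v xor u ∙ w
∙-⊕ʳ []      []      []      = refl
∙-⊕ʳ (a ∷ u) (b ∷ v) (c ∷ w) =
  trans (cong₂ _xor_ (∧-distribˡ-xor a b c) (∙-⊕ʳ u v w)) (xor-interchange (a ∧ b) _ _ _)

∙-comm : ∀ (u v : Vec Bool n) → u ∙ v ≡ v ∙ u
∙-comm []      []      = refl
∙-comm (a ∷ u) (b ∷ v) = cong₂ _xor_ (∧-comm a b) (∙-comm u v)

addIf-⊕ : ∀ a b (r u v : Vec Bool n) → addIf (a xor b) r (u ⊕ v) ≡ addIf a r u ⊕ addIf b r v
addIf-⊕ false false r u v = refl
addIf-⊕ false true  r u v = trans (sym (⊕-assoc r u v)) (trans (cong (_⊕ v) (⊕-comm r u)) (⊕-assoc u r v))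
addIf-⊕ true  false r u v = sym (⊕-assoc r u v)
addIf-⊕ true  true  r u v = sym (trans (⊕-interchange r u r v) (trans (cong (_⊕ (u ⊕ v)) (⊕-same r)) (𝟎-⊕ _)))

·-⊕ : ∀ (G : PairBits n) u v → G · (u ⊕ v) ≡ G · u ⊕ G · v
·-⊕ []       []      []      = refl
·-⊕ (r ∷ rs) (a ∷ u) (b ∷ v) = cong₂ _∷_ (∙-⊕ʳ r u v)
  (trans (cong (addIf (a xor b) r) (·-⊕ rs u v)) (addIf-⊕ a b r (rs · u) (rs · v)))

∙-addIfʳ : ∀ w b (r u : Vec Bool n) → w ∙ addIf b r u ≡ (b ∧ r ∙ w) xor w ∙ u
∙-addIfʳ w false r u = refl
∙-addIfʳ w true  r u = trans (∙-⊕ʳ w r u) (cong (_xor w ∙ u) (∙-comm w r))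

·-selfAdjoint : ∀ (G : PairBits n) u v → (G · u) ∙ v ≡ (G · v) ∙ u
·-selfAdjoint []       []      []      = refl
·-selfAdjoint (r ∷ rs) (a ∷ u) (b ∷ v) = begin
  ((r ∙ u) ∧ b) xor (addIf a r (rs · u)) ∙ v      ≡⟨ side (r ∙ u) a b v (rs · u) ⟩
  (b ∧ r ∙ u) xor ((a ∧ r ∙ v) xor (rs · u) ∙ v)  ≡⟨ xor-assoc (b ∧ r ∙ u) _ _ ⟨
  ((b ∧ r ∙ u) xor (a ∧ r ∙ v)) xor (rs · u) ∙ v  ≡⟨ cong₂ _xor_ (xor-comm (b ∧ r ∙ u) _) (·-selfAdjoint rs u v) ⟩
  ((a ∧ r ∙ v) xor (b ∧ r ∙ u)) xor (rs · v) ∙ u  ≡⟨ xor-assoc (a ∧ r ∙ v) _ _ ⟩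
  (a ∧ r ∙ v) xor ((b ∧ r ∙ u) xor (rs · v) ∙ u)  ≡⟨ side (r ∙ v) b a u (rs · v) ⟨
  ((r ∙ v) ∧ a) xor (addIf b r (rs · v)) ∙ u      ∎
  where
  open ≡-Reasoning
  side : ∀ x c d w z → (x ∧ d) xor (addIf c r z) ∙ w ≡ (d ∧ x) xor ((c ∧ r ∙ w) xor z ∙ w)
  side x c d w z = cong₂ _xor_ (∧-comm x d)
    (trans (∙-comm _ w) (trans (∙-addIfʳ w c r z) (cong ((c ∧ r ∙ w) xor_) (∙-comm w z))))

-- A basis in echelon form of a subspace of codimension m of 𝔽₂ⁿ, together with
-- a prescribed value in W at each basis vector.
data System (W : Set) : ℕ → ℕ → Set where
  nil   : System W 0 0
  skip  : System W m n → System W (suc m) (suc n)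
  pivot : Vec Bool n → W → System W m n → System W m (suc n)

module _ {W : Set} where

  Satisfies : {V : Set} → (W → V) → (Vec Bool n → V) → System W m n → Set
  Satisfies f L nil           = ⊤
  Satisfies f L (skip e)      = Satisfies f (L ∘ (false ∷_)) e
  Satisfies f L (pivot u s e) = L (true ∷ u) ≡ f s × Satisfies f (L ∘ (false ∷_)) e

  satisfies? : {V : Set} → (∀ (x y : V) → Dec (x ≡ y)) →
    ∀ (f : W → V) (L : Vec Bool n → V) (e : System W m n) → Dec (Satisfies f L e)
  satisfies? _≟_ f L nil           = yes tt
  satisfies? _≟_ f L (skip e)      = satisfies? _≟_ f (L ∘ (false ∷_)) e
  satisfies? _≟_ f L (pivot u s e) = (L (true ∷ u) ≟ f s) ×-dec satisfies? _≟_ f (L ∘ (false ∷_)) e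

  satisfies-map : {V V′ : Set} (g : V → V′) {f : W → V} {f′ : W → V′} {L : Vec Bool n → V} {L′ : Vec Bool n → V′} →
    (∀ w → g (f w) ≡ f′ w) → (∀ v → g (L v) ≡ L′ v) →
    (e : System W m n) → Satisfies f L e → Satisfies f′ L′ e
  satisfies-map g f≈ L≈ nil           s       = tt
  satisfies-map g f≈ L≈ (skip e)      s       = satisfies-map g f≈ (L≈ ∘ (false ∷_)) e s
  satisfies-map g f≈ L≈ (pivot u t e) (x , s) =
    trans (sym (L≈ _)) (trans (cong g x) (f≈ t)) , satisfies-map g f≈ (L≈ ∘ (false ∷_)) e s

  inSpan : System W m n → Vec Bool n → Bool
  inSpan nil           []      = true
  inSpan (skip e)      (b ∷ v) = not b ∧ inSpan e v
  inSpan (pivot u s e) (b ∷ v) = inSpan e (addIf b u v)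

  inSpan-full : (e : System W 0 n) (v : Vec Bool n) → inSpan e v ≡ true
  inSpan-full nil           []      = refl
  inSpan-full (pivot u s e) (b ∷ v) = inSpan-full e (addIf b u v)

  emptySystem : ∀ n → System W n n
  emptySystem zero    = nil
  emptySystem (suc n) = skip (emptySystem n)

∑-translate : ∀ (u : Vec Bool n) f → ∑ (vecs n) (f ∘ (u ⊕_)) ≡ ∑ (vecs n) f
∑-translate []          f = trans (∑-vecs-zero (f ∘ ([] ⊕_))) (sym (∑-vecs-zero f))
∑-translate (false ∷ u) f = begin
  ∑ (vecs _) (f ∘ ((false ∷ u) ⊕_))                 ≡⟨ ∑-vecs-suc _ (f ∘ ((false ∷ u) ⊕_)) ⟩
  ∑ (vecs _) (f ∘ (true ∷_) ∘ (u ⊕_)) + ∑ (vecs _) (f ∘ (false ∷_) ∘ (u ⊕_))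
    ≡⟨ cong₂ _+_ (∑-translate u _) (∑-translate u _) ⟩
  ∑ (vecs _) (f ∘ (true ∷_)) + ∑ (vecs _) (f ∘ (false ∷_)) ≡⟨ ∑-vecs-suc _ f ⟨
  ∑ (vecs _) f  ∎
  where open ≡-Reasoning
∑-translate (true ∷ u) f = begin
  ∑ (vecs _) (f ∘ ((true ∷ u) ⊕_))                 ≡⟨ ∑-vecs-suc _ (f ∘ ((true ∷ u) ⊕_)) ⟩
  ∑ (vecs _) (f ∘ (false ∷_) ∘ (u ⊕_)) + ∑ (vecs _) (f ∘ (true ∷_) ∘ (u ⊕_))
    ≡⟨ cong₂ _+_ (∑-translate u _) (∑-translate u _) ⟩
  ∑ (vecs _) (f ∘ (false ∷_)) + ∑ (vecs _) (f ∘ (true ∷_)) ≡⟨ +-comm (∑ (vecs _) (f ∘ (false ∷_))) _ ⟩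
  ∑ (vecs _) (f ∘ (true ∷_)) + ∑ (vecs _) (f ∘ (false ∷_)) ≡⟨ ∑-vecs-suc _ f ⟨
  ∑ (vecs _) f  ∎
  where open ≡-Reasoning

𝟙ᵇ : Bool → ℕ
𝟙ᵇ b = if b then 1 else 0

∑-inSpan : ∀ {W} (e : System W m n) → ∑ (vecs n) (𝟙ᵇ ∘ inSpan e) * 2 ^ m ≡ 2 ^ n
∑-inSpan nil = trans (*-identityʳ _) (∑-vecs-zero (𝟙ᵇ ∘ inSpan nil))
∑-inSpan {suc m} {suc n} (skip e) = begin
  ∑ (vecs (suc n)) (𝟙ᵇ ∘ inSpan (skip e)) * 2 ^ suc m
    ≡⟨ cong (_* 2 ^ suc m) (∑-vecs-suc n _) ⟩
  (∑ (vecs n) (const 0) + s) * 2 ^ suc m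
    ≡⟨ cong (λ z → (z + s) * 2 ^ suc m) (trans (∑-const (vecs n) 0) (*-zeroʳ (length (vecs n)))) ⟩
  s * (2 * 2 ^ m)   ≡⟨ *-x∙yz≈y∙xz s 2 (2 ^ m) ⟩
  2 * (s * 2 ^ m)   ≡⟨ cong (2 *_) (∑-inSpan e) ⟩
  2 ^ suc n         ∎
  where
  open ≡-Reasoning
  s = ∑ (vecs n) (𝟙ᵇ ∘ inSpan e)
∑-inSpan {m} {suc n} (pivot u t e) = begin
  ∑ (vecs (suc n)) (𝟙ᵇ ∘ inSpan (pivot u t e)) * 2 ^ m
    ≡⟨ cong (_* 2 ^ m) (∑-vecs-suc n _) ⟩
  (∑ (vecs n) (𝟙ᵇ ∘ inSpan e ∘ (u ⊕_)) + s) * 2 ^ m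
    ≡⟨ cong (λ z → (z + s) * 2 ^ m) (∑-translate u _) ⟩
  (s + s) * 2 ^ m   ≡⟨ double s (2 ^ m) ⟩
  2 * (s * 2 ^ m)   ≡⟨ cong (2 *_) (∑-inSpan e) ⟩
  2 ^ suc n         ∎
  where
  open ≡-Reasoning
  s = ∑ (vecs n) (𝟙ᵇ ∘ inSpan e)
  double : ∀ a b → (a + a) * b ≡ 2 * (a * b)
  double = solve-∀

module _ {k : ℕ} where

  adjoin : (e : System (Vec Bool k) (suc m) n) (v : Vec Bool n) → Vec Bool k →
    inSpan e v ≡ false → System (Vec Bool k) m n
  adjoin         (skip e)      (true ∷ v)  t p = pivot v t e
  adjoin {zero}  (skip e)      (false ∷ v) t p with () ← trans (sym (inSpan-full e v)) p
  adjoin {suc m} (skip e)      (false ∷ v) t p = skip (adjoin e v t p)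
  adjoin         (pivot u s e) (b ∷ v)     t p = pivot u s (adjoin e (addIf b u v) (addIf b s t) p)

  inSpan-adjoin : (e : System (Vec Bool k) (suc m) n) (v : Vec Bool n) (t t′ : Vec Bool k) →
    ∀ p w → inSpan (adjoin e v t p) w ≡ inSpan (adjoin e v t′ p) w
  inSpan-adjoin         (skip e)      (true ∷ v)  t t′ p (a ∷ w) = refl
  inSpan-adjoin {zero}  (skip e)      (false ∷ v) t t′ p w with () ← trans (sym (inSpan-full e v)) p
  inSpan-adjoin {suc m} (skip e)      (false ∷ v) t t′ p (a ∷ w) = cong (not a ∧_) (inSpan-adjoin e v t t′ p w)
  inSpan-adjoin         (pivot u s e) (b ∷ v)     t t′ p (a ∷ w) =
    inSpan-adjoin e (addIf b u v) (addIf b s t) (addIf b s t′) p (addIf a u w)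

  satisfies-adjoin : {V : Set} (_+_ : V → V → V) (f : Vec Bool k → V) (L : Vec Bool n → V) →
    (∀ x y → f (x ⊕ y) ≡ f x + f y) → (∀ x y → L (x ⊕ y) ≡ L x + L y) →
    (e : System (Vec Bool k) (suc m) n) (v : Vec Bool n) (t : Vec Bool k) → ∀ p →
    Satisfies f L e → L v ≡ f t → Satisfies f L (adjoin e v t p)
  satisfies-adjoin {m = m} _+_ f L f+ L+ (skip e) (true ∷ v) t p s q = q , s
  satisfies-adjoin {m = zero} _+_ f L f+ L+ (skip e) (false ∷ v) t p s q with () ← trans (sym (inSpan-full e v)) p
  satisfies-adjoin {m = suc m} _+_ f L f+ L+ (skip e) (false ∷ v) t p s q =
    satisfies-adjoin _+_ f (L ∘ (false ∷_)) f+ (λ x y → L+ (false ∷ x) (false ∷ y)) e v t p s q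
  satisfies-adjoin _+_ f L f+ L+ (pivot u x e) (true ∷ v) t p (y , s) q = y ,
    satisfies-adjoin _+_ f (L ∘ (false ∷_)) f+ (λ x y → L+ (false ∷ x) (false ∷ y)) e _ _ p s
      (trans (L+ (true ∷ u) (true ∷ v)) (trans (cong₂ _+_ y q) (sym (f+ x t))))
  satisfies-adjoin _+_ f L f+ L+ (pivot u x e) (false ∷ v) t p (y , s) q = y ,
    satisfies-adjoin _+_ f (L ∘ (false ∷_)) f+ (λ x y → L+ (false ∷ x) (false ∷ y)) e _ _ p s q

module _ {W : Set} where

  ∙-satisfies? : (f : W → Bool) (e : System W m n) (w : Vec Bool n) → Dec (Satisfies f (w ∙_) e)
  ∙-satisfies? f e w = satisfies? _≟ᵇ_ f (w ∙_) e

  ·-satisfies? : (f : W → Vec Bool n) (e : System W m n) (G : PairBits n) → Dec (Satisfies f (G ·_) e)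
  ·-satisfies? f e G = satisfies? _≟ᵛ_ f (G ·_) e

  private
    strip : ∀ b (f : W → Bool) (e : System W m n) w →
      Satisfies f (λ v → (b ∷ w) ∙ (false ∷ v)) e → Satisfies f (w ∙_) e
    strip b f e w = satisfies-map id (λ _ → refl) (λ v → cong (_xor w ∙ v) (∧-comm b false)) e

  ∑-∙-satisfies : (f : W → Bool) (e : System W m n) → ∑ (vecs n) (λ w → 𝟙 (∙-satisfies? f e w)) ≤ 2 ^ m
  ∑-∙-satisfies f nil = ≤-reflexive (∑-vecs-zero _)
  ∑-∙-satisfies {suc m} {suc n} f (skip e) = begin
    ∑ (vecs (suc n)) (λ w → 𝟙 (∙-satisfies? f (skip e) w))  ≡⟨ ∑-vecs-suc n _ ⟩
    ∑ (vecs n) _ + ∑ (vecs n) _  ≤⟨ +-mono-≤ (half true) (half false) ⟩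
    2 ^ m + 2 ^ m                ≡⟨ cong (2 ^ m +_) (+-identityʳ _) ⟨
    2 ^ suc m                    ∎
    where
    open ≤-Reasoning
    half : ∀ b → ∑ (vecs n) (λ w → 𝟙 (∙-satisfies? f (skip e) (b ∷ w))) ≤ 2 ^ m
    half b = ≤-trans (∑-mono (vecs n) λ w → 𝟙-mono (∙-satisfies? f (skip e) (b ∷ w)) (∙-satisfies? f e w) (strip b f e w))
      (∑-∙-satisfies f e)
  ∑-∙-satisfies {m} {suc n} f (pivot u s e) = begin
    ∑ (vecs (suc n)) (λ w → 𝟙 (∙-satisfies? f (pivot u s e) w))  ≡⟨ ∑-vecs-suc n _ ⟩
    ∑ (vecs n) (term true) + ∑ (vecs n) (term false)              ≡⟨ ∑-+ (vecs n) (term true) (term false) ⟨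
    ∑ (vecs n) (λ w → term true w + term false w)                 ≤⟨ ∑-mono (vecs n) atMostOne ⟩
    ∑ (vecs n) (λ w → 𝟙 (∙-satisfies? f e w))                    ≤⟨ ∑-∙-satisfies f e ⟩
    2 ^ m                                                         ∎
    where
    open ≤-Reasoning
    term : Bool → Vec Bool n → ℕ
    term b w = 𝟙 (∙-satisfies? f (pivot u s e) (b ∷ w))
    exclusive : ∀ c → true xor c ≡ f s → false xor c ≡ f s → ⊥
    exclusive c x y = absurd c (trans x (sym y))
      where
      absurd : ∀ c → not c ≡ c → ⊥
      absurd true ()
      absurd false ()
    atMostOne : ∀ w → term true w + term false w ≤ 𝟙 (∙-satisfies? f e w)
    atMostOne w with f s ≟ᵇ (w ∙ u)
    ... | yes q = ≤-trans (≤-reflexive (cong (_+ term false w) (𝟙-no (∙-satisfies? f (pivot u s e) (true ∷ w))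
                    λ (x , _) → exclusive (w ∙ u) x (sym q))))
                  (𝟙-mono (∙-satisfies? f (pivot u s e) (false ∷ w)) (∙-satisfies? f e w) λ (_ , s) → strip false f e w s)
    ... | no ¬q = ≤-trans (≤-reflexive (trans (cong (term true w +_) (𝟙-no (∙-satisfies? f (pivot u s e) (false ∷ w))
                    λ (x , _) → ¬q (sym x))) (+-identityʳ _)))
                  (𝟙-mono (∙-satisfies? f (pivot u s e) (true ∷ w)) (∙-satisfies? f e w) λ (_ , s) → strip true f e w s)

∑-≟ᵛ : ∀ (t : Vec Bool n) → ∑ (vecs n) (λ v → 𝟙 (v ≟ᵛ t)) ≡ 1
∑-≟ᵛ [] = ∑-vecs-zero _
∑-≟ᵛ {suc n} (b ∷ t) = trans (∑-vecs-suc n _) (split b)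
  where
  same : ∀ c → ∑ (vecs n) (λ v → 𝟙 ((c ∷ v) ≟ᵛ (c ∷ t))) ≡ 1
  same c = trans (∑-cong (vecs n) λ v → 𝟙-cong ((c ∷ v) ≟ᵛ (c ∷ t)) (v ≟ᵛ t) ∷-injectiveʳ (cong (c ∷_))) (∑-≟ᵛ t)
  diff : ∀ c d → c ≢ d → ∑ (vecs n) (λ v → 𝟙 ((c ∷ v) ≟ᵛ (d ∷ t))) ≡ 0
  diff c d c≢d = trans (∑-cong (vecs n) λ v → 𝟙-no ((c ∷ v) ≟ᵛ (d ∷ t)) (c≢d ∘ ∷-injectiveˡ))
    (trans (∑-const (vecs n) 0) (*-zeroʳ (length (vecs n))))
  split : ∀ b → ∑ (vecs n) (λ v → 𝟙 ((true ∷ v) ≟ᵛ (b ∷ t))) + ∑ (vecs n) (λ v → 𝟙 ((false ∷ v) ≟ᵛ (b ∷ t))) ≡ 1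
  split true  = cong₂ _+_ (same true) (diff false true λ ())
  split false = cong₂ _+_ (diff true false λ ()) (same false)

module _ {W : Set} where

  ∑-·-satisfies : (f : W → Vec Bool n) (e : System W m n) →
    ∑ (graphs n) (λ G → 𝟙 (·-satisfies? f e G)) ≤ graphCount m
  ∑-·-satisfies f nil = ≤-reflexive (∑-graphs-zero _)
  ∑-·-satisfies {suc n} {suc m} f (skip e) = begin
    ∑ (graphs (suc n)) (λ G → 𝟙 (·-satisfies? f (skip e) G))
      ≡⟨ ∑-graphs-∷ n _ ⟩
    ∑ (vecs n) (λ r → ∑ (graphs n) λ G → 𝟙 (·-satisfies? f (skip e) (r ∷ G)))
      ≤⟨ (∑-mono (vecs n) λ r → ∑-mono (graphs n) λ G → ≤-trans
           (𝟙-mono (·-satisfies? f (skip e) (r ∷ G)) (∙-satisfies? (head ∘ f) e r ×-dec ·-satisfies? (tail ∘ f) e G)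
              λ s → satisfies-map head (λ _ → refl) (λ _ → refl) e s ,
                    satisfies-map tail (λ _ → refl) (λ _ → refl) e s)
           (𝟙-×-≤ (∙-satisfies? (head ∘ f) e r) (·-satisfies? (tail ∘ f) e G))) ⟩
    ∑ (vecs n) (λ r → ∑ (graphs n) λ G → 𝟙 (∙-satisfies? (head ∘ f) e r) * 𝟙 (·-satisfies? (tail ∘ f) e G))
      ≤⟨ (∑-mono (vecs n) λ r → ≤-trans (≤-reflexive (∑-*ˡ (graphs n) (𝟙 (∙-satisfies? (head ∘ f) e r)) _))
            (≤-trans (*-monoʳ-≤ (𝟙 (∙-satisfies? (head ∘ f) e r)) (∑-·-satisfies (tail ∘ f) e))
              (≤-reflexive (*-comm _ (graphCount m))))) ⟩
    ∑ (vecs n) (λ r → graphCount m * 𝟙 (∙-satisfies? (head ∘ f) e r))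
      ≡⟨ ∑-*ˡ (vecs n) (graphCount m) _ ⟩
    graphCount m * ∑ (vecs n) (λ r → 𝟙 (∙-satisfies? (head ∘ f) e r))
      ≤⟨ *-monoʳ-≤ (graphCount m) (∑-∙-satisfies (head ∘ f) e) ⟩
    graphCount m * 2 ^ m
      ≡⟨ *-comm (graphCount m) _ ⟩
    graphCount (suc m) ∎
    where open ≤-Reasoning
  -- The pivot equation determines the first row from the remaining rows.
  ∑-·-satisfies {suc n} {m} f (pivot u s e) = begin
    ∑ (graphs (suc n)) (λ G → 𝟙 (·-satisfies? f (pivot u s e) G))
      ≡⟨ ∑-graphs-∷ n _ ⟩
    ∑ (vecs n) (λ r → ∑ (graphs n) λ G → 𝟙 (·-satisfies? f (pivot u s e) (r ∷ G)))
      ≡⟨ ∑-swap (vecs n) (graphs n) _ ⟩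
    ∑ (graphs n) (λ G → ∑ (vecs n) λ r → 𝟙 (·-satisfies? f (pivot u s e) (r ∷ G)))
      ≤⟨ (∑-mono (graphs n) λ G → ∑-mono (vecs n) λ r → ≤-trans
           (𝟙-mono (·-satisfies? f (pivot u s e) (r ∷ G)) (·-satisfies? (tail ∘ f) e G ×-dec (r ≟ᵛ row G))
              λ (x , s) → satisfies-map tail (λ _ → refl) (λ _ → refl) e s , determined G r (cong tail x))
           (𝟙-×-≤ (·-satisfies? (tail ∘ f) e G) (r ≟ᵛ row G))) ⟩
    ∑ (graphs n) (λ G → ∑ (vecs n) λ r → 𝟙 (·-satisfies? (tail ∘ f) e G) * 𝟙 (r ≟ᵛ row G))
      ≡⟨ (∑-cong (graphs n) λ G → trans (∑-*ˡ (vecs n) (𝟙 (·-satisfies? (tail ∘ f) e G)) _)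
            (trans (cong (𝟙 (·-satisfies? (tail ∘ f) e G) *_) (∑-≟ᵛ (row G))) (*-identityʳ _))) ⟩
    ∑ (graphs n) (λ G → 𝟙 (·-satisfies? (tail ∘ f) e G))
      ≤⟨ ∑-·-satisfies (tail ∘ f) e ⟩
    graphCount m ∎
    where
    open ≤-Reasoning
    row : PairBits n → Vec Bool n
    row G = G · u ⊕ tail (f s)
    determined : ∀ G r → r ⊕ G · u ≡ tail (f s) → r ≡ row G
    determined G r x = trans (sym (⊕-cancel (G · u) r)) (cong (G · u ⊕_) (trans (⊕-comm (G · u) r) x))

-- Krylov sequences of random graphs

KrylovOrthogonal : ℕ → PairBits n → Vec Bool n → Vec Bool n → Set
KrylovOrthogonal zero    G w v = ⊤
KrylovOrthogonal (suc j) G w v = w ∙ v ≡ false × KrylovOrthogonal j G w (G · v)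

krylovOrthogonal? : ∀ j (G : PairBits n) w v → Dec (KrylovOrthogonal j G w v)
krylovOrthogonal? zero    G w v = yes tt
krylovOrthogonal? (suc j) G w v = (w ∙ v ≟ᵇ false) ×-dec krylovOrthogonal? j G w (G · v)

term-≤-∑ : ∀ (f : Vec Bool n → ℕ) t → f t ≤ ∑ (vecs n) f
term-≤-∑ {n} f t = begin
  f t                                        ≡⟨ *-identityʳ (f t) ⟨
  f t * 1                                    ≡⟨ cong (f t *_) (∑-≟ᵛ t) ⟨
  f t * ∑ (vecs n) (λ v → 𝟙 (v ≟ᵛ t))        ≡⟨ ∑-*ˡ (vecs n) (f t) (λ v → 𝟙 (v ≟ᵛ t)) ⟨
  ∑ (vecs n) (λ v → f t * 𝟙 (v ≟ᵛ t))        ≤⟨ ∑-mono (vecs n) pick ⟩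
  ∑ (vecs n) f                               ∎
  where
  open ≤-Reasoning
  pick : ∀ v → f t * 𝟙 (v ≟ᵛ t) ≤ f v
  pick v with v ≟ᵛ t
  ... | yes refl = ≤-reflexive (*-identityʳ (f v))
  ... | no _     = ≤-trans (≤-reflexive (*-zeroʳ (f t))) z≤n

module _ {n m : ℕ} (K : ℕ) (n≤K+m : n ≤ K + m) where

  private
    Q = 2 ^ K

    2^n≤ : ∀ j → 2 ^ n ≤ Q * 2 ^ (j + m)
    2^n≤ j = ≤-trans (^-monoʳ-≤ 2 (≤-trans n≤K+m (+-monoʳ-≤ K (m≤n+m m j))))
      (≤-reflexive (^-distribˡ-+-* 2 K (j + m)))

    inSpan-≤ : ∀ j (e : System (Vec Bool n) (j + m) n) → ∑ (vecs n) (𝟙ᵇ ∘ inSpan e) ≤ Q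
    inSpan-≤ j e = *-cancelʳ-≤ _ _ (2 ^ (j + m)) ⦃ m^n≢0 2 (j + m) ⦄
      (≤-trans (≤-reflexive (∑-inSpan e)) (2^n≤ j))

    error-step : ∀ j T →
      2 ^ n * (j * Q ^ suc j * T) + Q * (2 ^ n * T) ≤ suc j * Q ^ suc (suc j) * (2 ^ (j + m) * T)
    error-step j T = begin
      2 ^ n * (j * q * T) + Q * (2 ^ n * T)
        ≤⟨ +-mono-≤ (*-monoˡ-≤ (j * q * T) (2^n≤ j)) (*-mono-≤ Q≤q (*-monoˡ-≤ T (2^n≤ j))) ⟩
      Q * D * (j * q * T) + q * (Q * D * T)
        ≡⟨ rearrange Q D j q T ⟩
      suc j * (Q * q) * (D * T) ∎
      where
      open ≤-Reasoning
      q = Q ^ suc j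
      D = 2 ^ (j + m)
      Q≤q : Q ≤ q
      Q≤q = ≤-trans (≤-reflexive (sym (*-identityʳ Q))) (*-monoʳ-≤ Q (m^n>0 Q ⦃ m^n≢0 2 K ⦄ j))
      rearrange : ∀ Q D j q T → Q * D * (j * q * T) + q * (Q * D * T) ≡ (1 + j) * (Q * q) * (D * T)
      rearrange = solve-∀

  -- P describes a branch of the exploration that successively reveals G · v,
  -- G · G · v, …; the last two summands bound the contribution of the branches
  -- in which a revealed vector already lies in the span of its predecessors.
  ∑-krylovOrthogonal : ∀ j (e : System (Vec Bool n) (j + m) n) v
    {P : PairBits n → Set} (P? : ∀ G → Dec (P G)) → (∀ G → P G → Satisfies id (G ·_) e) →
    ∑ (graphs n) (λ G → ∑ (vecs n) λ w →
      𝟙 (P? G ×-dec ∙-satisfies? (const false) e w ×-dec krylovOrthogonal? j G w v))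
    ≤ 2 ^ m * ∑ (graphs n) (λ G → 𝟙 (P? G)) + j * Q ^ suc j * graphCount (j + m)
      + 𝟙ᵇ (inSpan e v) * (2 ^ n * graphCount (j + m))
  ∑-krylovOrthogonal zero e v P? sat = begin
    ∑ (graphs n) (λ G → ∑ (vecs n) λ w → 𝟙 (P? G ×-dec perp? w ×-dec yes tt))
      ≤⟨ (∑-mono (graphs n) λ G → ∑-mono (vecs n) λ w → ≤-trans
           (𝟙-mono (P? G ×-dec perp? w ×-dec yes tt) (P? G ×-dec perp? w) λ (p , s , _) → p , s)
           (𝟙-×-≤ (P? G) (perp? w))) ⟩
    ∑ (graphs n) (λ G → ∑ (vecs n) λ w → 𝟙 (P? G) * 𝟙 (perp? w))
      ≤⟨ (∑-mono (graphs n) λ G → begin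
           ∑ (vecs n) (λ w → 𝟙 (P? G) * 𝟙 (perp? w))  ≡⟨ ∑-*ˡ (vecs n) (𝟙 (P? G)) (λ w → 𝟙 (perp? w)) ⟩
           𝟙 (P? G) * ∑ (vecs n) (λ w → 𝟙 (perp? w))  ≤⟨ *-monoʳ-≤ (𝟙 (P? G)) (∑-∙-satisfies (const false) e) ⟩
           𝟙 (P? G) * 2 ^ m                            ≡⟨ *-comm (𝟙 (P? G)) _ ⟩
           2 ^ m * 𝟙 (P? G)                            ∎) ⟩
    ∑ (graphs n) (λ G → 2 ^ m * 𝟙 (P? G))
      ≡⟨ ∑-*ˡ (graphs n) (2 ^ m) (λ G → 𝟙 (P? G)) ⟩
    2 ^ m * ∑ (graphs n) (λ G → 𝟙 (P? G))
      ≤⟨ ≤-trans (m≤m+n _ 0) (m≤m+n _ _) ⟩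
    _ ∎
    where
    open ≤-Reasoning
    perp? = ∙-satisfies? (const false) e
  ∑-krylovOrthogonal (suc j) e v {P} P? sat with inSpan e v in v∈e
  ... | true = begin
    ∑ (graphs n) (λ G → ∑ (vecs n) λ w →
      𝟙 (P? G ×-dec ∙-satisfies? (const false) e w ×-dec krylovOrthogonal? (suc j) G w v))
      ≤⟨ (∑-mono (graphs n) λ G → ∑-mono (vecs n) λ w →
           𝟙-mono (P? G ×-dec ∙-satisfies? (const false) e w ×-dec krylovOrthogonal? (suc j) G w v)
             (·-satisfies? id e G) (sat G ∘ proj₁)) ⟩
    ∑ (graphs n) (λ G → ∑ (vecs n) (const (𝟙 (·-satisfies? id e G))))
      ≡⟨ ∑-cong (graphs n) (λ G → ∑-vecs-const n (𝟙 (·-satisfies? id e G))) ⟩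
    ∑ (graphs n) (λ G → 2 ^ n * 𝟙 (·-satisfies? id e G))
      ≡⟨ ∑-*ˡ (graphs n) (2 ^ n) (λ G → 𝟙 (·-satisfies? id e G)) ⟩
    2 ^ n * ∑ (graphs n) (λ G → 𝟙 (·-satisfies? id e G))
      ≤⟨ *-monoʳ-≤ (2 ^ n) (∑-·-satisfies id e) ⟩
    2 ^ n * graphCount (suc j + m)
      ≡⟨ +-identityʳ _ ⟨
    1 * (2 ^ n * graphCount (suc j + m))
      ≤⟨ m≤n+m _ (2 ^ m * ∑ (graphs n) (λ G → 𝟙 (P? G)) + suc j * Q ^ suc (suc j) * graphCount (suc j + m)) ⟩
    _ ∎
    where open ≤-Reasoning
  ... | false = begin
    ∑ (graphs n) (λ G → ∑ (vecs n) λ w →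
      𝟙 (P? G ×-dec ∙-satisfies? (const false) e w ×-dec krylovOrthogonal? (suc j) G w v))
      ≤⟨ (∑-mono (graphs n) λ G → ∑-mono (vecs n) λ w → ≤-trans
           (𝟙-mono (P? G ×-dec ∙-satisfies? (const false) e w ×-dec krylovOrthogonal? (suc j) G w v)
                   (branch? (G · v) G w)
              λ (p , s , o , os) → (p , refl) ,
                satisfies-adjoin _xor_ (const false) (w ∙_) (λ _ _ → refl) (∙-⊕ʳ w) e v (G · v) v∈e s o , os)
           (term-≤-∑ (λ t → 𝟙 (branch? t G w)) (G · v))) ⟩
    ∑ (graphs n) (λ G → ∑ (vecs n) λ w → ∑ (vecs n) λ t → 𝟙 (branch? t G w))
      ≡⟨ ∑-cong (graphs n) (λ G → ∑-swap (vecs n) (vecs n) λ w t → 𝟙 (branch? t G w)) ⟩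
    ∑ (graphs n) (λ G → ∑ (vecs n) λ t → ∑ (vecs n) λ w → 𝟙 (branch? t G w))
      ≡⟨ ∑-swap (graphs n) (vecs n) (λ G t → ∑ (vecs n) λ w → 𝟙 (branch? t G w)) ⟩
    ∑ (vecs n) (λ t → ∑ (graphs n) λ G → ∑ (vecs n) λ w → 𝟙 (branch? t G w))
      ≤⟨ ∑-mono (vecs n) (λ t → ≤-trans
           (∑-krylovOrthogonal j (e′ t) t (λ G → P? G ×-dec (G · v ≟ᵛ t)) λ G (p , q) →
             satisfies-adjoin _⊕_ id (G ·_) (λ _ _ → refl) (·-⊕ G) e v t v∈e (sat G p) q)
           (≤-reflexive (cong (λ b → 2 ^ m * a t + E + 𝟙ᵇ b * c) (inSpan-adjoin e v t 𝟎 v∈e t)))) ⟩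
    ∑ (vecs n) (λ t → 2 ^ m * a t + E + 𝟙ᵇ (inSpan (e′ 𝟎) t) * c)
      ≡⟨ trans (∑-+ (vecs n) (λ t → 2 ^ m * a t + E) _)
           (cong₂ _+_ (trans (∑-+ (vecs n) (λ t → 2 ^ m * a t) (const E))
             (cong₂ _+_ (∑-*ˡ (vecs n) (2 ^ m) a) (∑-vecs-const n E)))
             (trans (∑-cong (vecs n) λ t → *-comm (𝟙ᵇ (inSpan (e′ 𝟎) t)) c)
               (∑-*ˡ (vecs n) c (𝟙ᵇ ∘ inSpan (e′ 𝟎))))) ⟩
    2 ^ m * ∑ (vecs n) a + 2 ^ n * E + c * ∑ (vecs n) (𝟙ᵇ ∘ inSpan (e′ 𝟎))
      ≤⟨ +-mono-≤ (+-monoˡ-≤ (2 ^ n * E) (*-monoʳ-≤ (2 ^ m) ∑a≤))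
           (≤-trans (*-monoʳ-≤ c (inSpan-≤ j (e′ 𝟎))) (≤-reflexive (*-comm c Q))) ⟩
    2 ^ m * p + 2 ^ n * E + Q * c
      ≡⟨ +-assoc (2 ^ m * p) _ _ ⟩
    2 ^ m * p + (2 ^ n * E + Q * c)
      ≤⟨ +-monoʳ-≤ (2 ^ m * p) (error-step j (graphCount (j + m))) ⟩
    2 ^ m * p + suc j * Q ^ suc (suc j) * graphCount (suc j + m)
      ≡⟨ +-identityʳ _ ⟨
    _ ∎
    where
    open ≤-Reasoning
    e′ : Vec Bool n → System (Vec Bool n) (j + m) n
    e′ t = adjoin e v t v∈e
    p = ∑ (graphs n) (λ G → 𝟙 (P? G))
    E = j * Q ^ suc j * graphCount (j + m)
    c = 2 ^ n * graphCount (j + m)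
    branch? : ∀ t G w → Dec ((P G × G · v ≡ t) × Satisfies (const false) (w ∙_) (e′ t) × KrylovOrthogonal j G w t)
    branch? t G w = (P? G ×-dec (G · v ≟ᵛ t)) ×-dec ∙-satisfies? (const false) (e′ t) w ×-dec krylovOrthogonal? j G w t
    a : Vec Bool n → ℕ
    a t = ∑ (graphs n) (λ G → 𝟙 (P? G ×-dec (G · v ≟ᵛ t)))
    ∑a≤ : ∑ (vecs n) a ≤ p
    ∑a≤ = begin
      ∑ (vecs n) a
        ≡⟨ ∑-swap (vecs n) (graphs n) _ ⟩
      ∑ (graphs n) (λ G → ∑ (vecs n) λ t → 𝟙 (P? G ×-dec (G · v ≟ᵛ t)))
        ≤⟨ (∑-mono (graphs n) λ G → ∑-mono (vecs n) λ t → ≤-trans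
             (𝟙-mono (P? G ×-dec (G · v ≟ᵛ t)) (P? G ×-dec (t ≟ᵛ G · v)) λ (p , q) → p , sym q)
             (𝟙-×-≤ (P? G) (t ≟ᵛ G · v))) ⟩
      ∑ (graphs n) (λ G → ∑ (vecs n) λ t → 𝟙 (P? G) * 𝟙 (t ≟ᵛ G · v))
        ≡⟨ (∑-cong (graphs n) λ G → trans (∑-*ˡ (vecs n) (𝟙 (P? G)) (λ t → 𝟙 (t ≟ᵛ G · v)))
              (trans (cong (𝟙 (P? G) *_) (∑-≟ᵛ (G · v))) (*-identityʳ _))) ⟩
      p ∎

satisfies-empty : ∀ {W V : Set} n (f : W → V) (L : Vec Bool n → V) → Satisfies f L (emptySystem n)
satisfies-empty zero    f L = tt
satisfies-empty (suc n) f L = satisfies-empty n f _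

-- K (K + 2) ≤ m makes the total error at most the main term.
∑-krylovOrthogonal-𝟏 : ∀ K m → 1 ≤ K → K * (2 + K) ≤ m → let N = K + m in
  ∑ (graphs N) (λ G → ∑ (vecs N) λ w → 𝟙 (krylovOrthogonal? K G w 𝟏)) * 2 ^ K
  ≤ 2 * (2 ^ N * graphCount N)
∑-krylovOrthogonal-𝟏 K@(suc K-1) m _ K≪m = begin
  ∑ (graphs N) (λ G → ∑ (vecs N) λ w → 𝟙 (krylovOrthogonal? K G w 𝟏)) * Q
    ≤⟨ *-monoˡ-≤ Q (∑-mono (graphs N) λ G → ∑-mono (vecs N) λ w →
         𝟙-mono (krylovOrthogonal? K G w 𝟏)
           (yes tt ×-dec ∙-satisfies? (const false) (emptySystem {Vec Bool N} N) w ×-dec krylovOrthogonal? K G w 𝟏)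
           λ o → tt , satisfies-empty N (const false) (w ∙_) , o) ⟩
  ∑ (graphs N) (λ G → ∑ (vecs N) λ w →
    𝟙 (yes tt ×-dec ∙-satisfies? (const false) (emptySystem N) w ×-dec krylovOrthogonal? K G w 𝟏)) * Q
    ≤⟨ *-monoˡ-≤ Q (∑-krylovOrthogonal K ≤-refl K (emptySystem N) 𝟏 (λ _ → yes tt) λ G _ → satisfies-empty N id (G ·_)) ⟩
  (2 ^ m * ∑ (graphs N) (const 1) + K * Q ^ suc K * T + 0) * Q
    ≡⟨ cong (λ z → (2 ^ m * z + K * Q ^ suc K * T + 0) * Q) (trans (∑-graphs-const N 1) (*-identityʳ T)) ⟩
  (2 ^ m * T + K * Q ^ suc K * T + 0) * Q
    ≤⟨ *-monoˡ-≤ Q (+-monoˡ-≤ 0 (+-monoʳ-≤ (2 ^ m * T) (*-monoˡ-≤ T error≤))) ⟩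
  (2 ^ m * T + 2 ^ m * T + 0) * Q
    ≡⟨ rearrange (2 ^ m) T Q ⟩
  2 * (Q * 2 ^ m * T)
    ≡⟨ cong (λ z → 2 * (z * T)) (^-distribˡ-+-* 2 K m) ⟨
  2 * (2 ^ N * T) ∎
  where
  open ≤-Reasoning
  N = K + m
  Q = 2 ^ K
  T = graphCount N
  rearrange : ∀ a T Q → (a * T + a * T + 0) * Q ≡ 2 * (Q * a * T)
  rearrange = solve-∀
  error≤ : K * Q ^ suc K ≤ 2 ^ m
  error≤ = begin
    K * Q ^ suc K      ≤⟨ *-monoˡ-≤ (Q ^ suc K) (<⇒≤ (n<2^n K)) ⟩
    Q ^ suc (suc K)    ≡⟨ ^-*-assoc 2 K (2 + K) ⟩
    2 ^ (K * (2 + K))  ≤⟨ ^-monoʳ-≤ 2 K≪m ⟩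
    2 ^ m              ∎
    where
    n<2^n : ∀ n → n < 2 ^ n
    n<2^n zero    = s≤s z≤n
    n<2^n (suc n) = begin
      2 + n          ≡⟨ +-comm 1 (suc n) ⟩
      suc n + 1      ≤⟨ +-mono-≤ (n<2^n n) (≤-trans (m^n>0 2 n) (m≤m+n _ 0)) ⟩
      2 ^ suc n      ∎

-- Characteristic polynomials modulo 2

-- Opaque, because unification otherwise unfolds sums over Fin (suc n).
opaque
  ⨁ : (Fin n → Bool) → Bool
  ⨁ = BoolSum.sum

  ⨁-zero : ∀ (f : Fin 0 → Bool) → ⨁ f ≡ false
  ⨁-zero f = refl

  ⨁-suc : ∀ (f : Fin (suc n) → Bool) → ⨁ f ≡ f zero xor ⨁ (f ∘ suc)
  ⨁-suc f = refl

  ⨁-cong : ∀ {f g : Fin n → Bool} → f ≗ g → ⨁ f ≡ ⨁ g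
  ⨁-cong = BoolSum.sum-cong-≗

  ⨁-false : ∀ n → ⨁ {n} (const false) ≡ false
  ⨁-false = BoolSum.sum-replicate-zero

  ⨁-xor : ∀ (f g : Fin n → Bool) → ⨁ (λ i → f i xor g i) ≡ ⨁ f xor ⨁ g
  ⨁-xor = BoolSum.∑-distrib-+

  ⨁-comm : ∀ (f : Fin m → Fin n → Bool) → ⨁ (λ i → ⨁ (f i)) ≡ ⨁ (λ j → ⨁ λ i → f i j)
  ⨁-comm = BoolSum.∑-comm

  ⨁-remove : ∀ (f : Fin (suc n) → Bool) i → ⨁ f ≡ f i xor ⨁ (f ∘ punchIn i)
  ⨁-remove f i = BoolSum.sum-remove {i = i} f

  ∧-⨁ : ∀ b (f : Fin n → Bool) → b ∧ ⨁ f ≡ ⨁ (λ i → b ∧ f i)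
  ∧-⨁ = BoolSum.*-distribˡ-sum

  ⨁-∧ : ∀ b (f : Fin n → Bool) → ⨁ f ∧ b ≡ ⨁ (λ i → f i ∧ b)
  ⨁-∧ = BoolSum.*-distribʳ-sum

⨁-⨁-suc : ∀ (f : Fin (suc m) → Fin (suc n) → Bool) →
  ⨁ (λ i → ⨁ (f i)) ≡ ⨁ (f zero) xor (⨁ (λ i → f (suc i) zero) xor ⨁ (λ i → ⨁ (f (suc i) ∘ suc)))
⨁-⨁-suc f = trans (⨁-suc (λ i → ⨁ (f i))) (cong (⨁ (f zero) xor_)
  (trans (⨁-cong λ i → ⨁-suc (f (suc i))) (⨁-xor (λ i → f (suc i) zero) (λ i → ⨁ (f (suc i) ∘ suc)))))

punchIn-punchIn-pinch : ∀ (j : Fin (suc n)) k → punchIn (punchIn j k) (pinch k j) ≡ j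
punchIn-punchIn-pinch zero    zero    = refl
punchIn-punchIn-pinch zero    (suc k) = refl
punchIn-punchIn-pinch (suc j) zero    = refl
punchIn-punchIn-pinch (suc j) (suc k) = cong suc (punchIn-punchIn-pinch j k)

punchIn-comm : ∀ (j : Fin (suc (suc n))) k i →
  punchIn (punchIn j k) (punchIn (pinch k j) i) ≡ punchIn j (punchIn k i)
punchIn-comm zero    zero    i       = refl
punchIn-comm zero    (suc k) i       = refl
punchIn-comm (suc j) zero    i       = refl
punchIn-comm (suc j) (suc k) zero    = refl
punchIn-comm (suc j) (suc k) (suc i) = cong suc (punchIn-comm j k i)

-- The pairs (j , k) enumerate the ordered pairs (j , punchIn j k) of distinct
-- elements, and (punchIn j k , pinch k j) is the reversed pair.
⨁-reverse : ∀ (f : Fin (suc n) → Fin n → Bool) →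
  ⨁ (λ j → ⨁ (f j)) ≡ ⨁ (λ j → ⨁ λ k → f (punchIn j k) (pinch k j))
⨁-reverse {zero}  f = ⨁-cong λ j → trans (⨁-zero (f j)) (sym (⨁-zero _))
⨁-reverse {suc n} f = begin
  ⨁ (λ j → ⨁ (f j))
    ≡⟨ ⨁-⨁-suc f ⟩
  ⨁ (f zero) xor (⨁ (λ j → f (suc j) zero) xor ⨁ (λ j → ⨁ (f (suc j) ∘ suc)))
    ≡⟨ xor-assoc (⨁ (f zero)) _ _ ⟨
  (⨁ (f zero) xor ⨁ (λ j → f (suc j) zero)) xor ⨁ (λ j → ⨁ (f (suc j) ∘ suc))
    ≡⟨ cong₂ _xor_ (xor-comm (⨁ (f zero)) _) (⨁-reverse (λ j k → f (suc j) (suc k))) ⟩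
  (⨁ (λ j → f (suc j) zero) xor ⨁ (f zero)) xor rest
    ≡⟨ xor-assoc (⨁ (λ j → f (suc j) zero)) _ _ ⟩
  ⨁ (λ j → f (suc j) zero) xor (⨁ (f zero) xor rest)
    ≡⟨ ⨁-⨁-suc (λ j k → f (punchIn j k) (pinch k j)) ⟨
  ⨁ (λ j → ⨁ λ k → f (punchIn j k) (pinch k j)) ∎
  where
  open ≡-Reasoning
  rest = ⨁ (λ j → ⨁ λ k → f (suc (punchIn j k)) (suc (pinch k j)))

⨁-reversible : ∀ (f : Fin (suc n) → Fin n → Bool) →
  (∀ j k → f (punchIn j k) (pinch k j) ≡ f j k) → ⨁ (λ j → ⨁ (f j)) ≡ false
⨁-reversible {zero}  f inv = trans (⨁-cong λ j → ⨁-zero (f j)) (⨁-false 1)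
⨁-reversible {suc n} f inv = begin
  ⨁ (λ j → ⨁ (f j))
    ≡⟨ ⨁-⨁-suc f ⟩
  ⨁ (f zero) xor (⨁ (λ j → f (suc j) zero) xor ⨁ (λ j → ⨁ (f (suc j) ∘ suc)))
    ≡⟨ cong₂ (λ x y → ⨁ (f zero) xor (x xor y)) (⨁-cong (inv zero))
         (⨁-reversible (λ j k → f (suc j) (suc k)) (λ j k → inv (suc j) (suc k))) ⟩
  ⨁ (f zero) xor (⨁ (f zero) xor false)
    ≡⟨ cong (⨁ (f zero) xor_) (xor-identityʳ _) ⟩
  ⨁ (f zero) xor ⨁ (f zero)
    ≡⟨ xor-same (⨁ (f zero)) ⟩
  false ∎
  where open ≡-Reasoning

⨁-symmetric : ∀ (f : Fin n → Fin n → Bool) → (∀ i j → f i j ≡ f j i) → ⨁ (λ i → ⨁ (f i)) ≡ ⨁ (λ i → f i i)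
⨁-symmetric {zero}  f f-sym = trans (⨁-zero _) (sym (⨁-zero _))
⨁-symmetric {suc n} f f-sym = begin
  ⨁ (λ i → ⨁ (f i))
    ≡⟨ ⨁-⨁-suc f ⟩
  ⨁ (f zero) xor (⨁ (λ i → f (suc i) zero) xor ⨁ (λ i → ⨁ (f (suc i) ∘ suc)))
    ≡⟨ cong₂ _xor_ (⨁-suc (f zero)) (cong₂ _xor_ (⨁-cong (λ i → f-sym (suc i) zero))
         (⨁-symmetric (λ i j → f (suc i) (suc j)) (λ i j → f-sym (suc i) (suc j)))) ⟩
  (f zero zero xor r) xor (r xor s)
    ≡⟨ xor-assoc (f zero zero) r _ ⟩
  f zero zero xor (r xor (r xor s))
    ≡⟨ cong (f zero zero xor_) (xor-assoc r r s) ⟨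
  f zero zero xor ((r xor r) xor s)
    ≡⟨ cong (λ x → f zero zero xor (x xor s)) (xor-same r) ⟩
  f zero zero xor s
    ≡⟨ ⨁-suc (λ i → f i i) ⟨
  ⨁ (λ i → f i i) ∎
  where
  open ≡-Reasoning
  r = ⨁ (f zero ∘ suc)
  s = ⨁ (λ i → f (suc i) (suc i))

-- Polynomials over 𝔽₂ are represented by their coefficient sequences.
Seq : Set
Seq = ℕ → Bool

shift : Seq → Seq
shift s zero    = false
shift s (suc t) = s t

one : Seq
one zero    = true
one (suc t) = false

-- (d , a) stands for the polynomial d X + a.
Linear : Set
Linear = Bool × Bool

infixr 8 _⊛_

_⊛_ : Linear → Seq → Seq
((d , a) ⊛ s) t = (d ∧ shift s t) xor (a ∧ s t)

shift-cong : ∀ {s s′ : Seq} → s ≗ s′ → shift s ≗ shift s′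
shift-cong e zero    = refl
shift-cong e (suc t) = e t

shift-⨁ : ∀ (s : Fin n → Seq) t → shift (λ t → ⨁ λ i → s i t) t ≡ ⨁ (λ i → shift (s i) t)
shift-⨁ {n} s zero    = sym (⨁-false n)
shift-⨁     s (suc t) = refl

shift-∧ : ∀ b (s : Seq) t → shift (λ t → b ∧ s t) t ≡ b ∧ shift s t
shift-∧ b s zero    = sym (∧-zeroʳ b)
shift-∧ b s (suc t) = refl

shift-xor : ∀ (s s′ : Seq) t → shift (λ t → s t xor s′ t) t ≡ shift s t xor shift s′ t
shift-xor s s′ zero    = refl
shift-xor s s′ (suc t) = refl

⊛-cong : ∀ e {s s′ : Seq} → s ≗ s′ → e ⊛ s ≗ e ⊛ s′
⊛-cong (d , a) s≗ t = cong₂ _xor_ (cong (d ∧_) (shift-cong s≗ t)) (cong (a ∧_) (s≗ t))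

⊛-⨁ : ∀ e (s : Fin n → Seq) t → (e ⊛ λ t → ⨁ λ i → s i t) t ≡ ⨁ (λ i → (e ⊛ s i) t)
⊛-⨁ (d , a) s t = begin
  (d ∧ shift (λ t → ⨁ λ i → s i t) t) xor (a ∧ ⨁ (λ i → s i t))
    ≡⟨ cong₂ _xor_ (trans (cong (d ∧_) (shift-⨁ s t)) (∧-⨁ d (λ i → shift (s i) t))) (∧-⨁ a (λ i → s i t)) ⟩
  ⨁ (λ i → d ∧ shift (s i) t) xor ⨁ (λ i → a ∧ s i t)
    ≡⟨ ⨁-xor (λ i → d ∧ shift (s i) t) _ ⟨
  ⨁ (λ i → (d ∧ shift (s i) t) xor (a ∧ s i t)) ∎
  where open ≡-Reasoning

∧-swap : ∀ a b c → a ∧ b ∧ c ≡ b ∧ a ∧ c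
∧-swap a b c = trans (sym (∧-assoc a b c)) (trans (cong (_∧ c) (∧-comm a b)) (∧-assoc b a c))

⊛-comm : ∀ e f s → e ⊛ f ⊛ s ≗ f ⊛ e ⊛ s
⊛-comm (d , a) (d′ , a′) s t = begin
  (d ∧ shift (λ t → (d′ ∧ shift s t) xor (a′ ∧ s t)) t) xor (a ∧ ((d′ ∧ shift s t) xor (a′ ∧ s t)))
    ≡⟨ expand d a d′ a′ ⟩
  ((d ∧ d′ ∧ p) xor (d ∧ a′ ∧ q)) xor ((a ∧ d′ ∧ q) xor (a ∧ a′ ∧ r))
    ≡⟨ xor-interchange (d ∧ d′ ∧ p) (d ∧ a′ ∧ q) (a ∧ d′ ∧ q) (a ∧ a′ ∧ r) ⟩
  ((d ∧ d′ ∧ p) xor (a ∧ d′ ∧ q)) xor ((d ∧ a′ ∧ q) xor (a ∧ a′ ∧ r))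
    ≡⟨ cong₂ _xor_ (cong₂ _xor_ (∧-swap d d′ p) (∧-swap a d′ q)) (cong₂ _xor_ (∧-swap d a′ q) (∧-swap a a′ r)) ⟩
  ((d′ ∧ d ∧ p) xor (d′ ∧ a ∧ q)) xor ((a′ ∧ d ∧ q) xor (a′ ∧ a ∧ r))
    ≡⟨ expand d′ a′ d a ⟨
  (d′ ∧ shift (λ t → (d ∧ shift s t) xor (a ∧ s t)) t) xor (a′ ∧ ((d ∧ shift s t) xor (a ∧ s t))) ∎
  where
  open ≡-Reasoning
  p = shift (shift s) t
  q = shift s t
  r = s t
  expand : ∀ d a d′ a′ →
    (d ∧ shift (λ t → (d′ ∧ shift s t) xor (a′ ∧ s t)) t) xor (a ∧ ((d′ ∧ shift s t) xor (a′ ∧ s t))) ≡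
    ((d ∧ d′ ∧ p) xor (d ∧ a′ ∧ q)) xor ((a ∧ d′ ∧ q) xor (a ∧ a′ ∧ r))
  expand d a d′ a′ = cong₂ _xor_
    (trans (cong (d ∧_) (trans (shift-xor _ _ t) (cong₂ _xor_ (shift-∧ d′ (shift s) t) (shift-∧ a′ s t))))
      (∧-distribˡ-xor d (d′ ∧ p) (a′ ∧ q)))
    (∧-distribˡ-xor a (d′ ∧ q) (a′ ∧ r))

Matrix : ℕ → Set
Matrix n = Fin n → Fin n → Linear

minor : Matrix (suc n) → Fin (suc n) → Fin (suc n) → Matrix n
minor M i j i′ j′ = M (punchIn i i′) (punchIn j j′)

-- The determinant over 𝔽₂, where signs do not matter.
perm : Matrix n → Seq
perm {zero}  M   = one
perm {suc n} M t = ⨁ λ j → (M zero j ⊛ perm (minor M zero j)) t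

perm-cong : ∀ {M N : Matrix n} → (∀ i j → M i j ≡ N i j) → perm M ≗ perm N
perm-cong {zero}  e t = refl
perm-cong {suc n} {M} {N} e t = ⨁-cong λ j → trans
  (cong (λ c → (c ⊛ perm (minor M zero j)) t) (e zero j))
  (⊛-cong (N zero j) (perm-cong λ i k → e (suc i) (punchIn j k)) t)

perm-row : ∀ (M : Matrix (suc n)) x t → perm M t ≡ ⨁ λ j → (M x j ⊛ perm (minor M x j)) t
perm-row M zero t = refl
perm-row {suc n} M (suc x) t = begin
  ⨁ (λ j → (M zero j ⊛ perm (minor M zero j)) t)
    ≡⟨ (⨁-cong λ j → trans (⊛-cong (M zero j) (perm-row (minor M zero j) x) t) (⊛-⨁ (M zero j) _ t)) ⟩
  ⨁ (λ j → ⨁ λ k → (M zero j ⊛ M (suc x) (punchIn j k) ⊛ perm (minor (minor M zero j) x k)) t)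
    ≡⟨ ⨁-reverse (λ j k → (M zero j ⊛ M (suc x) (punchIn j k) ⊛ perm (minor (minor M zero j) x k)) t) ⟩
  ⨁ (λ j → ⨁ λ k → (M zero (punchIn j k) ⊛ M (suc x) (punchIn (punchIn j k) (pinch k j)) ⊛
                        perm (minor (minor M zero (punchIn j k)) x (pinch k j))) t)
    ≡⟨ (⨁-cong λ j → ⨁-cong λ k → trans
          (⊛-cong (M zero (punchIn j k)) (λ t → trans
            (cong (λ c → (M (suc x) c ⊛ perm (minor (minor M zero (punchIn j k)) x (pinch k j))) t) (punchIn-punchIn-pinch j k))
            (⊛-cong (M (suc x) j) (perm-cong λ a b → cong (M (suc (punchIn x a))) (punchIn-comm j k b)) t)) t)
          (⊛-comm (M zero (punchIn j k)) (M (suc x) j) _ t)) ⟩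
  ⨁ (λ j → ⨁ λ k → (M (suc x) j ⊛ M zero (punchIn j k) ⊛ perm (minor (minor M (suc x) j) zero k)) t)
    ≡⟨ (⨁-cong λ j → ⊛-⨁ (M (suc x) j) (λ k → M zero (punchIn j k) ⊛ perm (minor (minor M (suc x) j) zero k)) t) ⟨
  ⨁ (λ j → (M (suc x) j ⊛ perm (minor M (suc x) j)) t) ∎
  where open ≡-Reasoning

perm-column-zero : ∀ (M : Matrix (suc n)) t → perm M t ≡ ⨁ λ i → (M i zero ⊛ perm (minor M i zero)) t
perm-column-zero {zero}  M t = ⨁-cong λ { zero → refl }
perm-column-zero {suc n} M t = trans (⨁-suc (λ j → (M zero j ⊛ perm (minor M zero j)) t))
  (trans (cong ((M zero zero ⊛ perm (minor M zero zero)) t xor_) (begin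
  ⨁ (λ j → (M zero (suc j) ⊛ perm (minor M zero (suc j))) t)
    ≡⟨ (⨁-cong λ j → trans (⊛-cong (M zero (suc j)) (perm-column-zero (minor M zero (suc j))) t)
                            (⊛-⨁ (M zero (suc j)) _ t)) ⟩
  ⨁ (λ j → ⨁ λ i → (M zero (suc j) ⊛ M (suc i) zero ⊛ perm (minor (minor M (suc i) zero) zero j)) t)
    ≡⟨ ⨁-comm (λ j i → (M zero (suc j) ⊛ M (suc i) zero ⊛ perm (minor (minor M (suc i) zero) zero j)) t) ⟩
  ⨁ (λ i → ⨁ λ j → (M zero (suc j) ⊛ M (suc i) zero ⊛ perm (minor (minor M (suc i) zero) zero j)) t)
    ≡⟨ (⨁-cong λ i → trans (⨁-cong λ j → ⊛-comm (M zero (suc j)) (M (suc i) zero) _ t)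
          (sym (⊛-⨁ (M (suc i) zero) (λ j → M zero (suc j) ⊛ perm (minor (minor M (suc i) zero) zero j)) t))) ⟩
  ⨁ (λ i → (M (suc i) zero ⊛ perm (minor M (suc i) zero)) t) ∎))
  (sym (⨁-suc (λ i → (M i zero ⊛ perm (minor M i zero)) t))))
  where open ≡-Reasoning

perm-transpose : ∀ (M : Matrix n) → perm (flip M) ≗ perm M
perm-transpose {zero}  M t = refl
perm-transpose {suc n} M t = trans
  (⨁-cong λ j → ⊛-cong (M j zero) (perm-transpose (minor M j zero)) t)
  (sym (perm-column-zero M t))

-- For symmetric M the terms of the expansion along row and column x pair up
-- and cancel, except on the diagonal.
perm-symmetric : ∀ (M : Matrix (suc (suc n))) → (∀ i j → M i j ≡ M j i) → ∀ x t →
  perm M t ≡ (M x x ⊛ perm (minor M x x)) t xor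
             ⨁ λ j → (M x (punchIn x j) ⊛ M x (punchIn x j) ⊛ perm (minor (minor M x x) j j)) t
perm-symmetric M M-sym x t = begin
  perm M t
    ≡⟨ perm-row M x t ⟩
  ⨁ (λ j → (M x j ⊛ perm (minor M x j)) t)
    ≡⟨ ⨁-remove (λ j → (M x j ⊛ perm (minor M x j)) t) x ⟩
  (M x x ⊛ perm B) t xor ⨁ (λ j → (M x (punchIn x j) ⊛ perm (minor M x (punchIn x j))) t)
    ≡⟨ cong ((M x x ⊛ perm B) t xor_) (begin
         ⨁ (λ j → (M x (punchIn x j) ⊛ perm (minor M x (punchIn x j))) t)
           ≡⟨ (⨁-cong λ j → trans (⊛-cong (M x (punchIn x j)) (column j) t) (⊛-⨁ (M x (punchIn x j)) _ t)) ⟩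
         ⨁ (λ j → ⨁ (f j))
           ≡⟨ ⨁-symmetric f f-sym ⟩
         ⨁ (λ j → f j j) ∎) ⟩
  _ ∎
  where
  open ≡-Reasoning
  B = minor M x x
  f : Fin (suc _) → Fin (suc _) → Bool
  f j i = (M x (punchIn x j) ⊛ M x (punchIn x i) ⊛ perm (minor B i j)) t
  f-sym : ∀ j i → f j i ≡ f i j
  f-sym j i = trans
    (⊛-comm (M x (punchIn x j)) (M x (punchIn x i)) _ t)
    (⊛-cong (M x (punchIn x i)) (⊛-cong (M x (punchIn x j)) λ t → trans
      (sym (perm-transpose (minor B i j) t)) (perm-cong (λ a b → M-sym (punchIn x (punchIn i b)) (punchIn x (punchIn j a))) t)) t)
  column : ∀ j t → perm (minor M x (punchIn x j)) t ≡
    ⨁ λ i → (M x (punchIn x i) ⊛ perm (minor B i j)) t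
  column j t = begin
    perm N t
      ≡⟨ perm-transpose N t ⟨
    perm (flip N) t
      ≡⟨ perm-row (flip N) p t ⟩
    ⨁ (λ i → (N i p ⊛ perm (minor (flip N) p i)) t)
      ≡⟨ (⨁-cong λ i → trans
           (cong (λ e → (e ⊛ perm (minor (flip N) p i)) t)
              (trans (cong (M (punchIn x i)) (punchIn-punchIn-pinch x j)) (M-sym _ _)))
           (⊛-cong (M x (punchIn x i)) (λ t → trans (sym (perm-transpose (minor (flip N) p i) t))
              (perm-cong (λ a b → cong (M (punchIn x (punchIn i a))) (punchIn-comm x j b)) t)) t)) ⟩
    ⨁ (λ i → (M x (punchIn x i) ⊛ perm (minor B i j)) t) ∎
    where
    N = minor M x (punchIn x j)
    p = pinch j x

perm-degree : ∀ (M : Matrix n) t → n < t → perm M t ≡ false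
perm-degree {zero}  M (suc t) _ = refl
perm-degree {suc n} M (suc t) (s≤s n<t) = trans
  (⨁-cong λ j → cong₂ (λ x y → (proj₁ (M zero j) ∧ x) xor (proj₂ (M zero j) ∧ y))
    (perm-degree (minor M zero j) t n<t) (perm-degree (minor M zero j) (suc t) (m<n⇒m<1+n n<t)))
  (trans (⨁-cong λ j → cong₂ _xor_ (∧-zeroʳ (proj₁ (M zero j))) (∧-zeroʳ (proj₂ (M zero j)))) (⨁-false (suc n)))

characteristicMatrix : SimpleGraph n → Matrix n
characteristicMatrix G i j = does (i ≟ᶠ j) , adj G i j

φ : SimpleGraph n → Seq
φ G = perm (characteristicMatrix G)

φ-cong : ∀ (G H : SimpleGraph n) → (∀ i j → adj G i j ≡ adj H i j) → φ G ≗ φ H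
φ-cong G H e = perm-cong λ i j → cong (does (i ≟ᶠ j) ,_) (e i j)

does-≟ᶠ-sym : ∀ (i j : Fin n) → does (i ≟ᶠ j) ≡ does (j ≟ᶠ i)
does-≟ᶠ-sym i j with i ≟ᶠ j
... | yes refl = sym (dec-true (i ≟ᶠ i) refl)
... | no i≢j   = sym (dec-false (j ≟ᶠ i) (i≢j ∘ sym))

does-punchIn : ∀ (x : Fin (suc n)) i j → does (punchIn x i ≟ᶠ punchIn x j) ≡ does (i ≟ᶠ j)
does-punchIn x i j with i ≟ᶠ j
... | yes refl = dec-true (punchIn x i ≟ᶠ punchIn x i) refl
... | no i≢j   = dec-false (punchIn x i ≟ᶠ punchIn x j) (i≢j ∘ punchIn-injective x i j)

minor-characteristicMatrix : ∀ (G : SimpleGraph (suc n)) x i j →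
  minor (characteristicMatrix G) x x i j ≡ characteristicMatrix (G ∖ x) i j
minor-characteristicMatrix G x i j = cong (_, adj G (punchIn x i) (punchIn x j)) (does-punchIn x i j)

φ-expand : ∀ (G : SimpleGraph (suc (suc n))) x t →
  φ G t ≡ shift (φ (G ∖ x)) t xor ⨁ λ j → adj G x (punchIn x j) ∧ φ (G ∖ x ∖ j) t
φ-expand G x t = trans
  (perm-symmetric M (λ i j → cong₂ _,_ (does-≟ᶠ-sym i j) (SimpleGraph.sym G i j)) x t)
  (cong₂ _xor_ diagonal (⨁-cong offDiagonal))
  where
  M = characteristicMatrix G
  diagonal : (M x x ⊛ perm (minor M x x)) t ≡ shift (φ (G ∖ x)) t
  diagonal = begin
    (M x x ⊛ perm (minor M x x)) t
      ≡⟨ cong (λ e → (e ⊛ perm (minor M x x)) t) (cong₂ _,_ (dec-true (x ≟ᶠ x) refl) (SimpleGraph.irrefl G x)) ⟩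
    shift (perm (minor M x x)) t xor false
      ≡⟨ xor-identityʳ _ ⟩
    shift (perm (minor M x x)) t
      ≡⟨ shift-cong (perm-cong (minor-characteristicMatrix G x)) t ⟩
    shift (φ (G ∖ x)) t ∎
    where open ≡-Reasoning
  idem : ∀ a b → a ∧ a ∧ b ≡ a ∧ b
  idem true  b = refl
  idem false b = refl
  offDiagonal : ∀ j → (M x (punchIn x j) ⊛ M x (punchIn x j) ⊛ perm (minor (minor M x x) j j)) t
                    ≡ adj G x (punchIn x j) ∧ φ (G ∖ x ∖ j) t
  offDiagonal j = begin
    (M x (punchIn x j) ⊛ M x (punchIn x j) ⊛ perm (minor (minor M x x) j j)) t
      ≡⟨ cong (λ d → ((d , a) ⊛ (d , a) ⊛ perm (minor (minor M x x) j j)) t)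
           (dec-false (x ≟ᶠ punchIn x j) (punchInᵢ≢i x j ∘ sym)) ⟩
    a ∧ a ∧ perm (minor (minor M x x) j j) t
      ≡⟨ idem a _ ⟩
    a ∧ perm (minor (minor M x x) j j) t
      ≡⟨ cong (a ∧_) (perm-cong (λ i k → trans (minor-characteristicMatrix G x (punchIn j i) (punchIn j k))
           (minor-characteristicMatrix (G ∖ x) j i k)) t) ⟩
    a ∧ φ (G ∖ x ∖ j) t ∎
    where
    open ≡-Reasoning
    a = adj G x (punchIn x j)

φ-degree : ∀ (G : SimpleGraph n) t → n < t → φ G t ≡ false
φ-degree G = perm-degree (characteristicMatrix G)

φ-monic : ∀ (G : SimpleGraph n) → φ G n ≡ true
φ-monic {zero}  G = refl
φ-monic {suc n} G = trans (⨁-suc (λ j → (M zero j ⊛ perm (minor M zero j)) (suc n))) (cong₂ _xor_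
  (cong₂ _xor_ (φ-monic {n} (G ∖ zero)) (trans (cong (adj G zero zero ∧_) (φ-degree (G ∖ zero) (suc n) ≤-refl)) (∧-zeroʳ _)))
  (trans (⨁-cong λ j → trans
      (cong (adj G zero (suc j) ∧_) (perm-degree (minor M zero (suc j)) (suc n) ≤-refl)) (∧-zeroʳ _))
    (⨁-false n)))
  where M = characteristicMatrix G

-- Writing d for the vector of the φ (G ∖ i) and A for the adjacency matrix of
-- G, this is row i of (X² I + A) d = X φ(G) 𝟏.  It follows by expanding each
-- φ (G ∖ j) with j adjacent to i along i.
φ-∖-neighbours : ∀ (G : SimpleGraph (suc (suc (suc n)))) i t →
  ⨁ (λ j → adj G i j ∧ φ (G ∖ j) t) xor shift (shift (φ (G ∖ i))) t ≡ shift (φ G) t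
φ-∖-neighbours {n} G i t = begin
  ⨁ (λ j → adj G i j ∧ φ (G ∖ j) t) xor shift (shift (φ (G ∖ i))) t
    ≡⟨ cong (_xor shift (shift (φ (G ∖ i))) t) (begin
        ⨁ (λ j → adj G i j ∧ φ (G ∖ j) t)
          ≡⟨ ⨁-remove (λ j → adj G i j ∧ φ (G ∖ j) t) i ⟩
        (adj G i i ∧ φ (G ∖ i) t) xor ⨁ (λ j → a j ∧ φ (G ∖ punchIn i j) t)
          ≡⟨ cong (λ b → (b ∧ φ (G ∖ i) t) xor ⨁ (λ j → a j ∧ φ (G ∖ punchIn i j) t)) (SimpleGraph.irrefl G i) ⟩
        ⨁ (λ j → a j ∧ φ (G ∖ punchIn i j) t)
          ≡⟨ ⨁-cong (λ j → trans (cong (a j ∧_) (expand j)) (∧-distribˡ-xor (a j) _ _)) ⟩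
        ⨁ (λ j → (a j ∧ shift (φ (G ∖ i ∖ j)) t) xor (a j ∧ ⨁ (λ k → a (punchIn j k) ∧ φ (G ∖ i ∖ j ∖ k) t)))
          ≡⟨ ⨁-xor (λ j → a j ∧ shift (φ (G ∖ i ∖ j)) t) _ ⟩
        N xor ⨁ (λ j → a j ∧ ⨁ (λ k → a (punchIn j k) ∧ φ (G ∖ i ∖ j ∖ k) t))
          ≡⟨ cong (N xor_) (trans (⨁-cong (λ j → ∧-⨁ (a j) _)) (⨁-reversible f f-reverse)) ⟩
        N xor false
          ≡⟨ xor-identityʳ N ⟩
        N ∎) ⟩
  N xor shift (shift (φ (G ∖ i))) t
    ≡⟨ xor-comm N _ ⟩
  shift (shift (φ (G ∖ i))) t xor N
    ≡⟨ cong (shift (shift (φ (G ∖ i))) t xor_) (trans (shift-⨁ (λ j t → a j ∧ φ (G ∖ i ∖ j) t) t)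
         (⨁-cong λ j → shift-∧ (a j) (φ (G ∖ i ∖ j)) t)) ⟨
  shift (shift (φ (G ∖ i))) t xor shift (λ t → ⨁ (λ j → a j ∧ φ (G ∖ i ∖ j) t)) t
    ≡⟨ shift-xor (shift (φ (G ∖ i))) _ t ⟨
  shift (λ t → shift (φ (G ∖ i)) t xor ⨁ (λ j → a j ∧ φ (G ∖ i ∖ j) t)) t
    ≡⟨ shift-cong (φ-expand G i) t ⟨
  shift (φ G) t ∎
  where
  open ≡-Reasoning
  a : Fin (suc (suc n)) → Bool
  a j = adj G i (punchIn i j)
  N = ⨁ (λ j → a j ∧ shift (φ (G ∖ i ∖ j)) t)
  f : Fin (suc (suc n)) → Fin (suc n) → Bool
  f j k = a j ∧ a (punchIn j k) ∧ φ (G ∖ i ∖ j ∖ k) t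
  expand : ∀ j → φ (G ∖ punchIn i j) t ≡
    shift (φ (G ∖ i ∖ j)) t xor ⨁ (λ k → a (punchIn j k) ∧ φ (G ∖ i ∖ j ∖ k) t)
  expand j = trans (φ-expand (G ∖ punchIn i j) (pinch j i) t) (cong₂ _xor_
    (shift-cong (φ-cong (G ∖ punchIn i j ∖ pinch j i) (G ∖ i ∖ j) G∖∖) t)
    (⨁-cong λ k → cong₂ _∧_
      (cong₂ (adj G) (punchIn-punchIn-pinch i j) (punchIn-comm i j k))
      (φ-cong (G ∖ punchIn i j ∖ pinch j i ∖ k) (G ∖ i ∖ j ∖ k) (λ b c → G∖∖ (punchIn k b) (punchIn k c)) t)))
    where
    G∖∖ : ∀ b c → adj (G ∖ punchIn i j ∖ pinch j i) b c ≡ adj (G ∖ i ∖ j) b c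
    G∖∖ b c = cong₂ (adj G) (punchIn-comm i j b) (punchIn-comm i j c)
  f-reverse : ∀ j k → f (punchIn j k) (pinch k j) ≡ f j k
  f-reverse j k = begin
    a (punchIn j k) ∧ a (punchIn (punchIn j k) (pinch k j)) ∧ φ (G ∖ i ∖ punchIn j k ∖ pinch k j) t
      ≡⟨ cong₂ (λ x y → a (punchIn j k) ∧ x ∧ y) (cong a (punchIn-punchIn-pinch j k))
           (φ-cong (G ∖ i ∖ punchIn j k ∖ pinch k j) (G ∖ i ∖ j ∖ k)
              (λ b c → cong₂ (adj (G ∖ i)) (punchIn-comm j k b) (punchIn-comm j k c)) t) ⟩
    a (punchIn j k) ∧ a j ∧ φ (G ∖ i ∖ j ∖ k) t
      ≡⟨ ∧-swap (a (punchIn j k)) (a j) _ ⟩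
    f j k ∎

Relation : SimpleGraph (suc n) → (Fin (suc n) → Bool) → Set
Relation G w = ∀ t → ⨁ (λ i → w i ∧ φ (G ∖ i) t) ≡ false

module _ (G : SimpleGraph (suc (suc (suc n)))) (w : Fin (suc (suc (suc n))) → Bool) (rel : Relation G w) where

  private
    Aw : Fin (suc (suc (suc n))) → Bool
    Aw j = ⨁ λ i → adj G j i ∧ w i

    ∧-exchange : ∀ a b c → a ∧ b ∧ c ≡ (b ∧ a) ∧ c
    ∧-exchange a b c = trans (sym (∧-assoc a b c)) (cong (_∧ c) (∧-comm a b))

    relation-Aw : ∀ t → ⨁ (λ j → Aw j ∧ φ (G ∖ j) t) ≡ ⨁ w ∧ shift (φ G) t
    relation-Aw t = begin
      ⨁ (λ j → Aw j ∧ φ (G ∖ j) t)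
        ≡⟨ (⨁-cong λ j → trans (⨁-∧ (φ (G ∖ j) t) (λ i → adj G j i ∧ w i))
              (⨁-cong λ i → trans (cong (λ b → (b ∧ w i) ∧ φ (G ∖ j) t) (SimpleGraph.sym G j i))
                              (sym (∧-exchange (w i) (adj G i j) _)))) ⟩
      ⨁ (λ j → ⨁ λ i → w i ∧ adj G i j ∧ φ (G ∖ j) t)
        ≡⟨ ⨁-comm (λ j i → w i ∧ adj G i j ∧ φ (G ∖ j) t) ⟩
      ⨁ (λ i → ⨁ λ j → w i ∧ adj G i j ∧ φ (G ∖ j) t)
        ≡⟨ (⨁-cong λ i → sym (∧-⨁ (w i) (λ j → adj G i j ∧ φ (G ∖ j) t))) ⟩
      ⨁ (λ i → w i ∧ ⨁ λ j → adj G i j ∧ φ (G ∖ j) t)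
        ≡⟨ xor-identityʳ _ ⟨
      ⨁ (λ i → w i ∧ ⨁ λ j → adj G i j ∧ φ (G ∖ j) t) xor false
        ≡⟨ cong (⨁ (λ i → w i ∧ ⨁ λ j → adj G i j ∧ φ (G ∖ j) t) xor_) (shifted t) ⟨
      ⨁ (λ i → w i ∧ ⨁ λ j → adj G i j ∧ φ (G ∖ j) t) xor ⨁ (λ i → w i ∧ shift (shift (φ (G ∖ i))) t)
        ≡⟨ ⨁-xor (λ i → w i ∧ ⨁ λ j → adj G i j ∧ φ (G ∖ j) t) _ ⟨
      ⨁ (λ i → (w i ∧ ⨁ λ j → adj G i j ∧ φ (G ∖ j) t) xor (w i ∧ shift (shift (φ (G ∖ i))) t))
        ≡⟨ (⨁-cong λ i → trans (sym (∧-distribˡ-xor (w i) _ _)) (cong (w i ∧_) (φ-∖-neighbours G i t))) ⟩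
      ⨁ (λ i → w i ∧ shift (φ G) t)
        ≡⟨ ⨁-∧ (shift (φ G) t) w ⟨
      ⨁ w ∧ shift (φ G) t ∎
      where
      open ≡-Reasoning
      shifted : ∀ t → ⨁ (λ i → w i ∧ shift (shift (φ (G ∖ i))) t) ≡ false
      shifted zero          = trans (⨁-cong λ i → ∧-zeroʳ (w i)) (⨁-false (suc (suc (suc n))))
      shifted (suc zero)    = trans (⨁-cong λ i → ∧-zeroʳ (w i)) (⨁-false (suc (suc (suc n))))
      shifted (suc (suc t)) = rel t

  -- Compare the coefficients of X^(|G| + 1): the degree of φ (G ∖ j) is |G| - 1.
  relation-sum : ⨁ w ≡ false
  relation-sum = begin
    ⨁ w                          ≡⟨ ∧-identityʳ (⨁ w) ⟨
    ⨁ w ∧ true                   ≡⟨ cong (⨁ w ∧_) (φ-monic G) ⟨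
    ⨁ w ∧ φ G N                  ≡⟨ relation-Aw (suc N) ⟨
    ⨁ (λ j → Aw j ∧ φ (G ∖ j) (suc N))
      ≡⟨ (⨁-cong λ j → trans (cong (Aw j ∧_) (φ-degree (G ∖ j) (suc N) (m<n⇒m<1+n ≤-refl))) (∧-zeroʳ (Aw j))) ⟩
    ⨁ (λ (_ : Fin N) → false)    ≡⟨ ⨁-false N ⟩
    false                        ∎
    where
    open ≡-Reasoning
    N = suc (suc (suc n))

  relation-adj : Relation G Aw
  relation-adj t = trans (relation-Aw t) (cong (_∧ shift (φ G) t) relation-sum)

relation-cong : ∀ (G : SimpleGraph (suc n)) {w w′} → w ≗ w′ → Relation G w → Relation G w′
relation-cong G e rel t = trans (⨁-cong λ i → cong (_∧ φ (G ∖ i) t) (sym (e i))) (rel t)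

∙-⨁ : ∀ (u v : Vec Bool n) → u ∙ v ≡ ⨁ (λ i → lookup u i ∧ lookup v i)
∙-⨁ []      []      = sym (⨁-zero _)
∙-⨁ (a ∷ u) (b ∷ v) = trans (cong ((a ∧ b) xor_) (∙-⨁ u v)) (sym (⨁-suc _))

∙-𝟏 : ∀ (w : Vec Bool n) → w ∙ 𝟏 ≡ ⨁ (lookup w)
∙-𝟏 []      = sym (⨁-zero _)
∙-𝟏 (a ∷ w) = trans (cong₂ _xor_ (∧-identityʳ a) (∙-𝟏 w)) (sym (⨁-suc _))

lookup-addIf : ∀ b (r v : Vec Bool n) j → lookup (addIf b r v) j ≡ (lookup r j ∧ b) xor lookup v j
lookup-addIf false r v j = cong (_xor lookup v j) (sym (∧-zeroʳ (lookup r j)))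
lookup-addIf true (a ∷ r) (b ∷ v) zero    = cong (_xor b) (sym (∧-identityʳ a))
lookup-addIf true (a ∷ r) (b ∷ v) (suc j) = lookup-addIf true r v j

lookup-· : ∀ (G : PairBits n) w j → lookup (G · w) j ≡ ⨁ (λ i → bit G j i ∧ lookup w i)
lookup-· (r ∷ rs) (b ∷ w) zero    = trans (∙-⨁ r w) (sym (⨁-suc _))
lookup-· (r ∷ rs) (b ∷ w) (suc j) = trans (lookup-addIf b r (rs · w) j)
  (trans (cong ((lookup r j ∧ b) xor_) (lookup-· rs w j)) (sym (⨁-suc _)))

relation⇒krylovOrthogonal : 2 ≤ n → ∀ (H : PairBits (suc n)) w → Relation (toGraph H) (lookup w) →
  ∀ j → KrylovOrthogonal j H w 𝟏
relation⇒krylovOrthogonal (s≤s (s≤s _)) H w rel j = go j 𝟏 (λ u relᵤ → trans (∙-𝟏 u) (relation-sum (toGraph H) (lookup u) relᵤ))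
  where
  go : ∀ j v → (∀ u → Relation (toGraph H) (lookup u) → u ∙ v ≡ false) → KrylovOrthogonal j H w v
  go zero    v orth = tt
  go (suc j) v orth = orth w rel , go j (H · v) λ u relᵤ → begin
    u ∙ (H · v)  ≡⟨ ∙-comm u (H · v) ⟩
    (H · v) ∙ u  ≡⟨ ·-selfAdjoint H v u ⟩
    (H · u) ∙ v  ≡⟨ orth (H · u) (relation-cong (toGraph H) (λ j → sym (lookup-· H u j))
                      (relation-adj (toGraph H) (lookup u) relᵤ)) ⟩
    false        ∎
    where open ≡-Reasoning

odd : ℕ → Bool
odd zero    = false
odd (suc n) = not (odd n)

odd-+ : ∀ m n → odd (m + n) ≡ odd m xor odd n
odd-+ zero    n = refl
odd-+ (suc m) n = trans (cong not (odd-+ m n)) (not-distribˡ-xor (odd m) (odd n))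

odd-* : ∀ m n → odd (m * n) ≡ odd m ∧ odd n
odd-* zero    n = refl
odd-* (suc m) n = trans (odd-+ n (m * n)) (trans (cong (odd n xor_) (odd-* m n)) (absorb (odd m) (odd n)))
  where
  absorb : ∀ a b → b xor (a ∧ b) ≡ not a ∧ b
  absorb true  b = xor-same b
  absorb false b = xor-identityʳ b

oddℤ : ℤ → Bool
oddℤ i = odd ∣ i ∣

oddℤ-⊖ : ∀ m n → oddℤ (m ⊖ n) ≡ odd m xor odd n
oddℤ-⊖ m       zero    = sym (xor-identityʳ (odd m))
oddℤ-⊖ zero    (suc n) = refl
oddℤ-⊖ (suc m) (suc n) = begin
  oddℤ (suc m ⊖ suc n)          ≡⟨ cong oddℤ (ℤₚ.[1+m]⊖[1+n]≡m⊖n m n) ⟩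
  oddℤ (m ⊖ n)                  ≡⟨ oddℤ-⊖ m n ⟩
  odd m xor odd n               ≡⟨ xor-annihilates-not (odd m) (odd n) ⟨
  not (odd m) xor not (odd n)   ∎
  where open ≡-Reasoning

oddℤ-+ : ∀ i j → oddℤ (i +ℤ j) ≡ oddℤ i xor oddℤ j
oddℤ-+ (ℤ.+ m)      (ℤ.+ n)      = odd-+ m n
oddℤ-+ (ℤ.+ m)      -[1+ n ]   = oddℤ-⊖ m (suc n)
oddℤ-+ -[1+ m ]   (ℤ.+ n)      = trans (oddℤ-⊖ n (suc m)) (xor-comm (odd n) _)
oddℤ-+ -[1+ m ]   -[1+ n ]   = trans (cong odd (cong suc (sym (+-suc m n)))) (odd-+ (suc m) (suc n))

oddℤ-* : ∀ i j → oddℤ (i *ℤ j) ≡ oddℤ i ∧ oddℤ j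
oddℤ-* i j = trans (cong odd (ℤₚ.abs-* i j)) (odd-* ∣ i ∣ ∣ j ∣)

mod2 : Poly → Seq
mod2 p t = oddℤ (coeff p t)

coeff-+ₚ : ∀ p q t → coeff (p +ₚ q) t ≡ coeff p t +ℤ coeff q t
coeff-+ₚ []      q       t       = sym (ℤₚ.+-identityˡ _)
coeff-+ₚ (a ∷ p) []      t       = sym (ℤₚ.+-identityʳ _)
coeff-+ₚ (a ∷ p) (b ∷ q) zero    = refl
coeff-+ₚ (a ∷ p) (b ∷ q) (suc t) = coeff-+ₚ p q t

coeff-scale : ∀ a p t → coeff (map (a *ℤ_) p) t ≡ a *ℤ coeff p t
coeff-scale a []      t       = sym (ℤₚ.*-zeroʳ a)
coeff-scale a (b ∷ p) zero    = refl
coeff-scale a (b ∷ p) (suc t) = coeff-scale a p t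

mod2-+ₚ : ∀ p q t → mod2 (p +ₚ q) t ≡ mod2 p t xor mod2 q t
mod2-+ₚ p q t = trans (cong oddℤ (coeff-+ₚ p q t)) (oddℤ-+ (coeff p t) (coeff q t))

mod2-0∷ : ∀ p → mod2 (0ℤ ∷ p) ≗ shift (mod2 p)
mod2-0∷ p zero    = refl
mod2-0∷ p (suc t) = refl

mod2-∷-*ₚ : ∀ a p q t → mod2 ((a ∷ p) *ₚ q) t ≡ (oddℤ a ∧ mod2 q t) xor shift (mod2 (p *ₚ q)) t
mod2-∷-*ₚ a p q t = trans (mod2-+ₚ (map (a *ℤ_) q) (0ℤ ∷ p *ₚ q) t) (cong₂ _xor_
  (trans (cong oddℤ (coeff-scale a q t)) (oddℤ-* a (coeff q t)))
  (mod2-0∷ (p *ₚ q) t))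

mod2-*ₚ-zero : ∀ p q → (∀ t → mod2 p t ≡ false) → ∀ t → mod2 (p *ₚ q) t ≡ false
mod2-*ₚ-zero []      q p≗0 t = refl
mod2-*ₚ-zero (a ∷ p) q p≗0 t = trans (mod2-∷-*ₚ a p q t) (cong₂ _xor_
  (cong (_∧ mod2 q t) (p≗0 zero))
  (trans (shift-cong (mod2-*ₚ-zero p q (p≗0 ∘ suc)) t) (shift-false t)))
  where
  shift-false : ∀ t → shift (const false) t ≡ false
  shift-false zero    = refl
  shift-false (suc t) = refl

mod2-*ₚ-one : ∀ p q → mod2 p ≗ one → mod2 (p *ₚ q) ≗ mod2 q
mod2-*ₚ-one []      q p≗1 t with () ← p≗1 zero
mod2-*ₚ-one (a ∷ p) q p≗1 t = begin
  mod2 ((a ∷ p) *ₚ q) t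
    ≡⟨ mod2-∷-*ₚ a p q t ⟩
  (oddℤ a ∧ mod2 q t) xor shift (mod2 (p *ₚ q)) t
    ≡⟨ cong₂ _xor_ (cong (_∧ mod2 q t) (p≗1 zero)) (tail≗0 t) ⟩
  mod2 q t xor false
    ≡⟨ xor-identityʳ _ ⟩
  mod2 q t ∎
  where
  open ≡-Reasoning
  tail≗0 : ∀ t → shift (mod2 (p *ₚ q)) t ≡ false
  tail≗0 zero    = refl
  tail≗0 (suc t) = mod2-*ₚ-zero p q (p≗1 ∘ suc) t

open RawSemiringDefinitions (RawRing.rawSemiring polyRawRing) using () renaming (sum to sumₚ; _^_ to _^ₚ_)

mod2-sign : ∀ j → mod2 ((-ₚ constₚ 1ℤ) ^ₚ j) ≗ one
mod2-sign zero    zero    = refl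
mod2-sign zero    (suc t) = refl
mod2-sign (suc j) t = trans (mod2-*ₚ-one (-ₚ constₚ 1ℤ) ((-ₚ constₚ 1ℤ) ^ₚ j) minusOne t) (mod2-sign j t)
  where
  minusOne : mod2 (-ₚ constₚ 1ℤ) ≗ one
  minusOne zero    = refl
  minusOne (suc t) = refl

mod2-sum : ∀ (f : Fin n → Poly) t → mod2 (sumₚ f) t ≡ ⨁ (λ j → mod2 (f j) t)
mod2-sum {zero}  f t = sym (⨁-zero _)
mod2-sum {suc n} f t = trans (mod2-+ₚ (f zero) (sumₚ (f ∘ suc)) t)
  (trans (cong (mod2 (f zero) t xor_) (mod2-sum (f ∘ suc) t)) (sym (⨁-suc _)))

mod2-det : ∀ (P : Fin n → Fin n → Poly) (M : Matrix n) →
  (∀ i j q → mod2 (P i j *ₚ q) ≗ M i j ⊛ mod2 q) → mod2 (Determinant.det polyRawRing P) ≗ perm M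
mod2-det {zero}  P M P≗M zero    = refl
mod2-det {zero}  P M P≗M (suc t) = refl
mod2-det {suc n} P M P≗M t = trans
  (mod2-sum (λ j → (-ₚ constₚ 1ℤ) ^ₚ toℕ j *ₚ (P zero j *ₚ det (minorₚ j))) t)
  (⨁-cong λ j → trans
    (mod2-*ₚ-one ((-ₚ constₚ 1ℤ) ^ₚ toℕ j) (P zero j *ₚ det (minorₚ j)) (mod2-sign (toℕ j)) t)
    (trans (P≗M zero j (det (minorₚ j)) t)
      (⊛-cong (M zero j) (mod2-det (minorₚ j) (minor M zero j) λ i k → P≗M (suc i) (punchIn j k)) t)))
  where
  open Determinant polyRawRing using (det)
  minorₚ : Fin (suc n) → Fin n → Fin n → Poly
  minorₚ j i k = P (suc i) (punchIn j k)

mod2-linear : ∀ d a q →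
  mod2 (((if d then X else []) +ₚ -ₚ constₚ (if a then 1ℤ else 0ℤ)) *ₚ q) ≗ (d , a) ⊛ mod2 q
mod2-linear false a q t = begin
  mod2 ((-ℤ (if a then 1ℤ else 0ℤ) ∷ []) *ₚ q) t
    ≡⟨ mod2-∷-*ₚ (-ℤ (if a then 1ℤ else 0ℤ)) [] q t ⟩
  (oddℤ (-ℤ (if a then 1ℤ else 0ℤ)) ∧ mod2 q t) xor shift (mod2 []) t
    ≡⟨ cong₂ (λ x y → (x ∧ mod2 q t) xor y) (oddℤ-bit a) (zero-shift t) ⟩
  (a ∧ mod2 q t) xor false
    ≡⟨ xor-identityʳ _ ⟩
  a ∧ mod2 q t ∎
  where
  open ≡-Reasoning
  oddℤ-bit : ∀ a → oddℤ (-ℤ (if a then 1ℤ else 0ℤ)) ≡ a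
  oddℤ-bit true  = refl
  oddℤ-bit false = refl
  zero-shift : ∀ t → shift (mod2 []) t ≡ false
  zero-shift zero    = refl
  zero-shift (suc t) = refl
mod2-linear true a q t = begin
  mod2 ((0ℤ +ℤ -ℤ (if a then 1ℤ else 0ℤ) ∷ 1ℤ ∷ []) *ₚ q) t
    ≡⟨ mod2-∷-*ₚ (0ℤ +ℤ -ℤ (if a then 1ℤ else 0ℤ)) (constₚ 1ℤ) q t ⟩
  (oddℤ (0ℤ +ℤ -ℤ (if a then 1ℤ else 0ℤ)) ∧ mod2 q t) xor shift (mod2 (constₚ 1ℤ *ₚ q)) t
    ≡⟨ cong₂ (λ x y → (x ∧ mod2 q t) xor y) (oddℤ-bit a) (shift-cong (mod2-*ₚ-one (constₚ 1ℤ) q (mod2-sign 0)) t) ⟩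
  (a ∧ mod2 q t) xor shift (mod2 q) t
    ≡⟨ xor-comm (a ∧ mod2 q t) _ ⟩
  shift (mod2 q) t xor (a ∧ mod2 q t) ∎
  where
  open ≡-Reasoning
  oddℤ-bit : ∀ a → oddℤ (0ℤ +ℤ -ℤ (if a then 1ℤ else 0ℤ)) ≡ a
  oddℤ-bit true  = refl
  oddℤ-bit false = refl

mod2-charPoly : ∀ (G : SimpleGraph n) → mod2 (charPoly (adjacencyMatrix G)) ≗ φ G
mod2-charPoly G = mod2-det _ (characteristicMatrix G) λ i j → mod2-linear (does (i ≟ᶠ j)) (SimpleGraph.adj G i j)

-- Counting graphs with cospectral vertices

insertVertex : Fin (suc n) → Vec Bool n → PairBits n → PairBits (suc n)
insertVertex         zero    r       G       = r ∷ G
insertVertex {suc n} (suc x) (b ∷ r) (q ∷ G) = insertAt q x b ∷ insertVertex x r G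

bit-insertVertex-row : ∀ x (r : Vec Bool n) G j → bit (insertVertex x r G) x (punchIn x j) ≡ lookup r j
bit-insertVertex-row zero    r       G       j       = refl
bit-insertVertex-row (suc x) (b ∷ r) (q ∷ G) zero    = insertAt-lookup q x b
bit-insertVertex-row (suc x) (b ∷ r) (q ∷ G) (suc j) = bit-insertVertex-row x r G j

bit-insertVertex-∖ : ∀ x (r : Vec Bool n) G i j → bit (insertVertex x r G) (punchIn x i) (punchIn x j) ≡ bit G i j
bit-insertVertex-∖ zero    r       G       i       j       = refl
bit-insertVertex-∖ (suc x) (b ∷ r) (q ∷ G) zero    zero    = refl
bit-insertVertex-∖ (suc x) (b ∷ r) (q ∷ G) zero    (suc j) = insertAt-punchIn q x b j
bit-insertVertex-∖ (suc x) (b ∷ r) (q ∷ G) (suc i) zero    = insertAt-punchIn q x b i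
bit-insertVertex-∖ (suc x) (b ∷ r) (q ∷ G) (suc i) (suc j) = bit-insertVertex-∖ x r G i j

∑-insertAt : ∀ x (f : Vec Bool (suc n) → ℕ) →
  ∑ (vecs (suc n)) f ≡ ∑ bools λ b → ∑ (vecs n) λ v → f (insertAt v x b)
∑-insertAt {n} zero f = ∑-vecs-∷ n f
∑-insertAt {suc n} (suc x) f = begin
  ∑ (vecs (suc (suc n))) f
    ≡⟨ ∑-vecs-∷ (suc n) f ⟩
  ∑ bools (λ c → ∑ (vecs (suc n)) λ u → f (c ∷ u))
    ≡⟨ ∑-cong bools (λ c → ∑-insertAt x (f ∘ (c ∷_))) ⟩
  ∑ bools (λ c → ∑ bools λ b → ∑ (vecs n) λ v → f (c ∷ insertAt v x b))
    ≡⟨ ∑-swap bools bools (λ c b → ∑ (vecs n) λ v → f (c ∷ insertAt v x b)) ⟩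
  ∑ bools (λ b → ∑ bools λ c → ∑ (vecs n) λ v → f (c ∷ insertAt v x b))
    ≡⟨ ∑-cong bools (λ b → ∑-vecs-∷ n (λ v → f (insertAt v (suc x) b))) ⟨
  ∑ bools (λ b → ∑ (vecs (suc n)) λ v → f (insertAt v (suc x) b)) ∎
  where open ≡-Reasoning

∑-insertVertex : ∀ x (f : PairBits (suc n) → ℕ) →
  ∑ (graphs (suc n)) f ≡ ∑ (vecs n) λ r → ∑ (graphs n) λ G → f (insertVertex x r G)
∑-insertVertex {n} zero f = ∑-graphs-∷ n f
∑-insertVertex {suc n} (suc x) f = begin
  ∑ (graphs (suc (suc n))) f
    ≡⟨ ∑-graphs-∷ (suc n) f ⟩
  ∑ (vecs (suc n)) (λ p → ∑ (graphs (suc n)) λ C → f (p ∷ C))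
    ≡⟨ ∑-cong (vecs (suc n)) (λ p → ∑-insertVertex x (f ∘ (p ∷_))) ⟩
  ∑ (vecs (suc n)) (λ p → ∑ (vecs n) λ r → ∑ (graphs n) λ G → f (p ∷ insertVertex x r G))
    ≡⟨ ∑-insertAt x (λ p → ∑ (vecs n) λ r → ∑ (graphs n) λ G → f (p ∷ insertVertex x r G)) ⟩
  ∑ bools (λ b → ∑ (vecs n) λ q → ∑ (vecs n) λ r → g b r q)
    ≡⟨ ∑-cong bools (λ b → ∑-swap (vecs n) (vecs n) (λ q r → g b r q)) ⟩
  ∑ bools (λ b → ∑ (vecs n) λ r → ∑ (vecs n) λ q → g b r q)
    ≡⟨ ∑-cong bools (λ b → ∑-cong (vecs n) λ r →
         ∑-graphs-∷ n (λ C → f (insertVertex (suc x) (b ∷ r) C))) ⟨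
  ∑ bools (λ b → ∑ (vecs n) λ r → ∑ (graphs (suc n)) λ C → f (insertVertex (suc x) (b ∷ r) C))
    ≡⟨ ∑-vecs-∷ n (λ r → ∑ (graphs (suc n)) λ C → f (insertVertex (suc x) r C)) ⟨
  ∑ (vecs (suc n)) (λ r → ∑ (graphs (suc n)) λ C → f (insertVertex (suc x) r C)) ∎
  where
  open ≡-Reasoning
  g : Bool → Vec Bool n → Vec Bool n → ℕ
  g b r q = ∑ (graphs n) λ G → f (insertAt q x b ∷ insertVertex x r G)

φ-expand-as : ∀ (G : SimpleGraph (suc (suc n))) v (H : SimpleGraph (suc n)) (u : Fin (suc n) → Bool) →
  (∀ j → adj G v (punchIn v j) ≡ u j) → (∀ i j → adj (G ∖ v) i j ≡ adj H i j) →
  ∀ t → φ G t ≡ shift (φ H) t xor ⨁ λ j → u j ∧ φ (H ∖ j) t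
φ-expand-as G v H u row rest t = trans (φ-expand G v t) (cong₂ _xor_
  (shift-cong (φ-cong (G ∖ v) H rest) t)
  (⨁-cong λ j → cong₂ _∧_ (row j)
    (φ-cong (G ∖ v ∖ j) (H ∖ j) (λ a b → rest (punchIn j a) (punchIn j b)) t)))

cospectral⇒relation : ∀ x k b (r s : Vec Bool (suc n)) H →
  let G = toGraph (insertVertex x (insertAt r k b) (insertVertex k s H)) in
  CospectralVertices G x (punchIn x k) → Relation (toGraph H) (lookup (s ⊕ r))
cospectral⇒relation x k b r s H cospectral t = begin
  ⨁ (λ j → lookup (s ⊕ r) j ∧ d j)
    ≡⟨ ⨁-cong (λ j → trans (cong (_∧ d j) (lookup-zipWith _xor_ j s r)) (∧-distribʳ-xor (d j) (lookup s j) (lookup r j))) ⟩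
  ⨁ (λ j → (lookup s j ∧ d j) xor (lookup r j ∧ d j))
    ≡⟨ ⨁-xor (λ j → lookup s j ∧ d j) (λ j → lookup r j ∧ d j) ⟩
  S xor R
    ≡⟨ cong (S xor_) (xor-cancelˡ (shift (φ (toGraph H)) t) (trans (sym φ∖x) (trans φ≡ φ∖y))) ⟨
  S xor S
    ≡⟨ xor-same S ⟩
  false ∎
  where
  open ≡-Reasoning
  C = insertVertex k s H
  G = toGraph (insertVertex x (insertAt r k b) C)
  y = punchIn x k
  x′ = pinch k x
  d : Fin (suc _) → Bool
  d j = φ (toGraph H ∖ j) t
  S = ⨁ (λ j → lookup s j ∧ d j)
  R = ⨁ (λ j → lookup r j ∧ d j)
  xor-cancelˡ : ∀ a {b c} → a xor b ≡ a xor c → b ≡ c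
  xor-cancelˡ a {b} {c} e = trans (sym (lemma a b)) (trans (cong (a xor_) e) (lemma a c))
    where
    lemma : ∀ a b → a xor (a xor b) ≡ b
    lemma a b = trans (sym (xor-assoc a a b)) (cong (_xor b) (xor-same a))
  φ≡ : φ (G ∖ x) t ≡ φ (G ∖ y) t
  φ≡ = trans (sym (mod2-charPoly (G ∖ x) t)) (trans (cong oddℤ (cospectral t)) (mod2-charPoly (G ∖ y) t))
  C-∖ : ∀ i j → adj (G ∖ x) i j ≡ bit C i j
  C-∖ = bit-insertVertex-∖ x (insertAt r k b) C
  H-∖ : ∀ i j → adj (G ∖ x ∖ k) i j ≡ bit H i j
  H-∖ i j = trans (C-∖ (punchIn k i) (punchIn k j)) (bit-insertVertex-∖ k s H i j)
  φ∖x : φ (G ∖ x) t ≡ shift (φ (toGraph H)) t xor S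
  φ∖x = φ-expand-as (G ∖ x) k (toGraph H) (lookup s)
    (λ j → trans (C-∖ k (punchIn k j)) (bit-insertVertex-row k s H j)) H-∖ t
  φ∖y : φ (G ∖ y) t ≡ shift (φ (toGraph H)) t xor R
  φ∖y = φ-expand-as (G ∖ y) x′ (toGraph H) (lookup r)
    (λ j → trans (cong₂ (adj G) (punchIn-punchIn-pinch x k) (punchIn-comm x k j))
      (trans (bit-insertVertex-row x (insertAt r k b) C (punchIn k j)) (insertAt-punchIn r k b j)))
    (λ i j → trans (cong₂ (adj G) (punchIn-comm x k i) (punchIn-comm x k j)) (H-∖ i j)) t

opaque
  cospectral? : ∀ (G : SimpleGraph n) x y → Dec (CospectralVertices G x y)
  cospectral? G x y = charPoly (adjacencyMatrix (G ∖ x)) ≈ₚ? charPoly (adjacencyMatrix (G ∖ y))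

KrylovBound : ℕ → ℕ → Set
KrylovBound K n =
  ∑ (graphs n) (λ H → ∑ (vecs n) λ w → 𝟙 (krylovOrthogonal? K H w 𝟏)) * 2 ^ K ≤ 2 * (2 ^ n * graphCount n)

∑-cospectral : ∀ K p → 2 ≤ p → KrylovBound K (suc p) → ∀ x k →
  ∑ (graphs (3 + p)) (λ G → 𝟙 (cospectral? (toGraph G) x (punchIn x k))) * 2 ^ K ≤ 2 * graphCount (3 + p)
∑-cospectral K p 2≤p bound x k = begin
  ∑ (graphs (2 + N)) (λ G → 𝟙 (cospectral? (toGraph G) x (punchIn x k))) * 2 ^ K
    ≡⟨ cong (_* 2 ^ K) (begin-equality
      ∑ (graphs (2 + N)) f
        ≡⟨ ∑-insertVertex x f ⟩
      ∑ (vecs (1 + N)) (λ r → ∑ (graphs (1 + N)) λ C → f (insertVertex x r C))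
        ≡⟨ ∑-cong (vecs (1 + N)) (λ r → ∑-insertVertex k (f ∘ insertVertex x r)) ⟩
      ∑ (vecs (1 + N)) (λ r → ∑ (vecs N) λ s → ∑ (graphs N) λ H → f (insertVertex x r (insertVertex k s H)))
        ≡⟨ ∑-insertAt k (λ r → ∑ (vecs N) λ s → ∑ (graphs N) λ H → f (insertVertex x r (insertVertex k s H))) ⟩
      ∑ bools (λ b → ∑ (vecs N) λ r → ∑ (vecs N) λ s → ∑ (graphs N) λ H → g b r s H) ∎) ⟩
  ∑ bools (λ b → ∑ (vecs N) λ r → ∑ (vecs N) λ s → ∑ (graphs N) λ H → g b r s H) * 2 ^ K
    ≤⟨ *-monoˡ-≤ (2 ^ K) (∑-mono bools λ b → ∑-mono (vecs N) λ r → inner b r) ⟩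
  ∑ bools (λ _ → ∑ (vecs N) λ _ → S) * 2 ^ K
    ≡⟨ cong (_* 2 ^ K) (trans (∑-const bools (∑ (vecs N) (const S))) (cong (2 *_) (∑-vecs-const N S))) ⟩
  2 * (2 ^ N * S) * 2 ^ K
    ≡⟨ rearrange₁ (2 ^ N) S (2 ^ K) ⟩
  2 * 2 ^ N * (S * 2 ^ K)
    ≤⟨ *-monoʳ-≤ (2 * 2 ^ N) bound ⟩
  2 * 2 ^ N * (2 * (2 ^ N * graphCount N))
    ≡⟨ rearrange₂ (2 ^ N) (graphCount N) ⟩
  2 * graphCount (2 + N) ∎
  where
  open ≤-Reasoning
  N = suc p
  f : PairBits (2 + N) → ℕ
  f G = 𝟙 (cospectral? (toGraph G) x (punchIn x k))
  g : Bool → Vec Bool N → Vec Bool N → PairBits N → ℕ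
  g b r s H = f (insertVertex x (insertAt r k b) (insertVertex k s H))
  h : PairBits N → Vec Bool N → ℕ
  h H w = 𝟙 (krylovOrthogonal? K H w 𝟏)
  S = ∑ (graphs N) (λ H → ∑ (vecs N) (h H))
  rearrange₁ : ∀ a s q → 2 * (a * s) * q ≡ 2 * a * (s * q)
  rearrange₁ = solve-∀
  rearrange₂ : ∀ a t → 2 * a * (2 * (a * t)) ≡ 2 * (2 * a * (a * t))
  rearrange₂ = solve-∀
  inner : ∀ b r → ∑ (vecs N) (λ s → ∑ (graphs N) λ H → g b r s H) ≤ S
  inner b r = begin
    ∑ (vecs N) (λ s → ∑ (graphs N) λ H → g b r s H)
      ≤⟨ (∑-mono (vecs N) λ s → ∑-mono (graphs N) λ H →
           𝟙-mono (cospectral? (toGraph (insertVertex x (insertAt r k b) (insertVertex k s H))) x (punchIn x k))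
                  (krylovOrthogonal? K H (r ⊕ s) 𝟏)
             λ c → subst (λ w → KrylovOrthogonal K H w 𝟏) (⊕-comm s r)
               (relation⇒krylovOrthogonal 2≤p H (s ⊕ r) (cospectral⇒relation x k b r s H c) K)) ⟩
    ∑ (vecs N) (λ s → ∑ (graphs N) λ H → h H (r ⊕ s))
      ≡⟨ ∑-swap (vecs N) (graphs N) (λ s H → h H (r ⊕ s)) ⟩
    ∑ (graphs N) (λ H → ∑ (vecs N) λ s → h H (r ⊕ s))
      ≡⟨ ∑-cong (graphs N) (λ H → ∑-translate r (h H)) ⟩
    S ∎

term-≤-∑-tabulate : ∀ (g : Fin n → A) f i → f (g i) ≤ ∑ (tabulate g) f
term-≤-∑-tabulate g f zero    = m≤m+n _ _
term-≤-∑-tabulate g f (suc i) = ≤-trans (term-≤-∑-tabulate (g ∘ suc) f i) (m≤n+m _ _)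

∑-allFin-≤ : ∀ n {f} c → (∀ i → f i ≤ c) → ∑ (allFin n) f ≤ n * c
∑-allFin-≤ n c f≤c = ≤-trans (∑-mono (allFin n) f≤c)
  (≤-reflexive (trans (∑-const (allFin n) c) (cong (_* c) (length-tabulate {n = n} id))))

𝟙-≤ : ∀ {P : Set} (d : Dec P) {b} → (P → 1 ≤ b) → 𝟙 d ≤ b
𝟙-≤ (yes p) f = f p
𝟙-≤ (no _)  f = z≤n

𝟙-¬noCospectralPair-≤ : ∀ (G : SimpleGraph (suc n)) →
  𝟙 (¬? (noCospectralPair? G)) ≤
  ∑ (allFin (suc n)) λ x → ∑ (allFin n) λ k → 𝟙 (cospectral? G x (punchIn x k))
𝟙-¬noCospectralPair-≤ {n} G = 𝟙-≤ (¬? (noCospectralPair? G)) (byPair ∘ decidable-stable pair?)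
  where
  pair? = any? λ x → any? λ y → ¬? (x ≟ᶠ y) ×-dec cospectral? G x y
  byPair : Σ (Fin (suc n)) (λ x → Σ (Fin (suc n)) λ y → x ≢ y × CospectralVertices G x y) → 1 ≤ _
  byPair (x , y , x≢y , c) = begin
    1
      ≤⟨ 𝟙-mono (yes c) (cospectral? G x (punchIn x (punchOut x≢y)))
           (subst (CospectralVertices G x) (sym (punchIn-punchOut x≢y))) ⟩
    𝟙 (cospectral? G x (punchIn x (punchOut x≢y)))
      ≤⟨ term-≤-∑-tabulate id (λ k → 𝟙 (cospectral? G x (punchIn x k))) (punchOut x≢y) ⟩
    ∑ (allFin n) (λ k → 𝟙 (cospectral? G x (punchIn x k)))
      ≤⟨ term-≤-∑-tabulate id (λ x → ∑ (allFin n) λ k → 𝟙 (cospectral? G x (punchIn x k))) x ⟩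
    ∑ (allFin (suc n)) (λ x → ∑ (allFin n) λ k → 𝟙 (cospectral? G x (punchIn x k))) ∎
    where open ≤-Reasoning

failures : ℕ → ℕ
failures n = ∑ (graphs n) λ G → 𝟙 (¬? (noCospectralPair? (toGraph G)))

failures-≤ : ∀ K p → 2 ≤ p → KrylovBound K (suc p) → let n = 3 + p in
  failures n * 2 ^ K ≤ n * n * (2 * graphCount n)
failures-≤ K p 2≤p bound = begin
  failures (suc N) * Q
    ≤⟨ *-monoˡ-≤ Q (∑-mono (graphs (suc N)) λ G → 𝟙-¬noCospectralPair-≤ (toGraph G)) ⟩
  ∑ (graphs (suc N)) (λ G → ∑ (allFin (suc N)) λ x → ∑ (allFin N) λ k → c G x k) * Q
    ≡⟨ cong (_* Q) (trans (∑-swap (graphs (suc N)) (allFin (suc N)) (λ G x → ∑ (allFin N) λ k → c G x k))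
         (∑-cong (allFin (suc N)) λ x → ∑-swap (graphs (suc N)) (allFin N) λ G k → c G x k)) ⟩
  ∑ (allFin (suc N)) (λ x → ∑ (allFin N) λ k → ∑ (graphs (suc N)) λ G → c G x k) * Q
    ≡⟨ *-comm _ Q ⟩
  Q * ∑ (allFin (suc N)) (λ x → ∑ (allFin N) λ k → ∑ (graphs (suc N)) λ G → c G x k)
    ≡⟨ trans (∑-cong (allFin (suc N)) λ x → ∑-*ˡ (allFin N) Q λ k → ∑ (graphs (suc N)) λ G → c G x k)
         (∑-*ˡ (allFin (suc N)) Q λ x → ∑ (allFin N) λ k → ∑ (graphs (suc N)) λ G → c G x k) ⟨
  ∑ (allFin (suc N)) (λ x → ∑ (allFin N) λ k → Q * ∑ (graphs (suc N)) λ G → c G x k)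
    ≤⟨ ∑-allFin-≤ (suc N) _ (λ x → ∑-allFin-≤ N _ λ k →
         ≤-trans (≤-reflexive (*-comm Q _)) (∑-cospectral K p 2≤p bound x k)) ⟩
  suc N * (N * (2 * graphCount (suc N)))
    ≤⟨ *-monoʳ-≤ (suc N) (*-monoˡ-≤ (2 * graphCount (suc N)) (n≤1+n N)) ⟩
  suc N * (suc N * (2 * graphCount (suc N)))
    ≡⟨ *-assoc (suc N) (suc N) (2 * graphCount (suc N)) ⟨
  suc N * suc N * (2 * graphCount (suc N)) ∎
  where
  open ≤-Reasoning
  Q = 2 ^ K
  N = 2 + p
  c : PairBits (suc N) → Fin (suc N) → Fin N → ℕ
  c G x k = 𝟙 (cospectral? (toGraph G) x (punchIn x k))

-- Probabilities

infix 9 ↑_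

↑_ : ℕ → ℚ
↑ n = ℤ.+ n / 1

↑-+ : ∀ m n → ↑ (m + n) ≡ ↑ m +ℚ ↑ n
↑-+ m n = ℚ.toℚᵘ-injective (begin-equality
  toℚᵘ (↑ (m + n))                     ≃⟨ ℚ.toℚᵘ-fromℚᵘ (ℚᵘ.mkℚᵘ (ℤ.+ (m + n)) 0) ⟩
  ℚᵘ.mkℚᵘ (ℤ.+ (m + n)) 0             ≃⟨ ℚᵘₚ.≃-reflexive (cong (λ i → ℚᵘ.mkℚᵘ i 0)
                                          (cong₂ _+ℤ_ (sym (ℤₚ.*-identityʳ (ℤ.+ m))) (sym (ℤₚ.*-identityʳ (ℤ.+ n))))) ⟩
  ℚᵘ.mkℚᵘ (ℤ.+ m) 0 ℚᵘ.+ ℚᵘ.mkℚᵘ (ℤ.+ n) 0 ≃⟨ ℚᵘₚ.+-cong (ℚ.toℚᵘ-fromℚᵘ (ℚᵘ.mkℚᵘ (ℤ.+ m) 0)) (ℚ.toℚᵘ-fromℚᵘ (ℚᵘ.mkℚᵘ (ℤ.+ n) 0)) ⟨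
  toℚᵘ (↑ m) ℚᵘ.+ toℚᵘ (↑ n)          ≃⟨ ℚ.toℚᵘ-homo-+ (↑ m) (↑ n) ⟨
  toℚᵘ (↑ m +ℚ ↑ n)                    ∎)
  where open ℚᵘₚ.≤-Reasoning

↑-* : ∀ m n → ↑ (m * n) ≡ ↑ m *ℚ ↑ n
↑-* m n = ℚ.toℚᵘ-injective (begin-equality
  toℚᵘ (↑ (m * n))                     ≃⟨ ℚ.toℚᵘ-fromℚᵘ (ℚᵘ.mkℚᵘ (ℤ.+ (m * n)) 0) ⟩
  ℚᵘ.mkℚᵘ (ℤ.+ (m * n)) 0             ≃⟨ ℚᵘₚ.≃-reflexive (cong (λ i → ℚᵘ.mkℚᵘ i 0) (ℤₚ.pos-* m n)) ⟩
  ℚᵘ.mkℚᵘ (ℤ.+ m) 0 ℚᵘ.* ℚᵘ.mkℚᵘ (ℤ.+ n) 0 ≃⟨ ℚᵘₚ.*-cong (ℚ.toℚᵘ-fromℚᵘ (ℚᵘ.mkℚᵘ (ℤ.+ m) 0)) (ℚ.toℚᵘ-fromℚᵘ (ℚᵘ.mkℚᵘ (ℤ.+ n) 0)) ⟨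
  toℚᵘ (↑ m) ℚᵘ.* toℚᵘ (↑ n)          ≃⟨ ℚ.toℚᵘ-homo-* (↑ m) (↑ n) ⟨
  toℚᵘ (↑ m *ℚ ↑ n)                    ∎)
  where open ℚᵘₚ.≤-Reasoning

↑-mono : ∀ {m n} → m ≤ n → ↑ m ≤ℚ ↑ n
↑-mono {m} {n} m≤n = ℚ.toℚᵘ-cancel-≤ (begin
  toℚᵘ (↑ m)       ≃⟨ ℚ.toℚᵘ-fromℚᵘ (ℚᵘ.mkℚᵘ (ℤ.+ m) 0) ⟩
  ℚᵘ.mkℚᵘ (ℤ.+ m) 0  ≤⟨ ℚᵘ.*≤* (ℤₚ.*-monoʳ-≤-nonNeg (ℤ.+ 1) (ℤ.+≤+ m≤n)) ⟩
  ℚᵘ.mkℚᵘ (ℤ.+ n) 0  ≃⟨ ℚ.toℚᵘ-fromℚᵘ (ℚᵘ.mkℚᵘ (ℤ.+ n) 0) ⟨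
  toℚᵘ (↑ n)       ∎)
  where open ℚᵘₚ.≤-Reasoning

𝔼 : Dist A → (A → ℚ) → ℚ
𝔼 []            f = 0ℚ
𝔼 ((a , p) ∷ d) f = p *ℚ f a +ℚ 𝔼 d f

𝔼-cong : ∀ (d : Dist A) {f g} → f ≗ g → 𝔼 d f ≡ 𝔼 d g
𝔼-cong []            e = refl
𝔼-cong ((a , p) ∷ d) e = cong₂ (λ x y → p *ℚ x +ℚ y) (e a) (𝔼-cong d e)

𝔼-++ : ∀ (d d′ : Dist A) f → 𝔼 (d ++ d′) f ≡ 𝔼 d f +ℚ 𝔼 d′ f
𝔼-++ []            d′ f = sym (ℚ.+-identityˡ _)
𝔼-++ ((a , p) ∷ d) d′ f = trans (cong (λ x → p *ℚ f a +ℚ x) (𝔼-++ d d′ f)) (sym (ℚ.+-assoc (p *ℚ f a) _ _))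

𝔼-scale : ∀ p (d : Dist A) f → 𝔼 (map (λ (a , q) → a , p *ℚ q) d) f ≡ p *ℚ 𝔼 d f
𝔼-scale p []            f = sym (ℚ.*-zeroʳ p)
𝔼-scale p ((a , q) ∷ d) f = trans (cong₂ _+ℚ_ (ℚ.*-assoc p q (f a)) (𝔼-scale p d f))
  (sym (ℚ.*-distribˡ-+ p (q *ℚ f a) (𝔼 d f)))

𝔼->>= : ∀ (d : Dist A) (e : A → Dist A′) f → 𝔼 (d >>= e) f ≡ 𝔼 d (λ a → 𝔼 (e a) f)
𝔼->>= []            e f = refl
𝔼->>= ((a , p) ∷ d) e f = trans (𝔼-++ (map (λ (b , q) → b , p *ℚ q) (e a)) (d >>= e) f)
  (cong₂ _+ℚ_ (𝔼-scale p (e a) f) (𝔼->>= d e f))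

𝔼-return : ∀ (a : A) f → 𝔼 (return a) f ≡ f a
𝔼-return a f = trans (ℚ.+-identityʳ _) (ℚ.*-identityˡ (f a))

𝔼-*ˡ : ∀ (d : Dist A) c f → 𝔼 d (λ a → c *ℚ f a) ≡ c *ℚ 𝔼 d f
𝔼-*ˡ []            c f = sym (ℚ.*-zeroʳ c)
𝔼-*ˡ ((a , p) ∷ d) c f = trans (cong₂ _+ℚ_ p*c (𝔼-*ˡ d c f)) (sym (ℚ.*-distribˡ-+ c (p *ℚ f a) (𝔼 d f)))
  where
  p*c : p *ℚ (c *ℚ f a) ≡ c *ℚ (p *ℚ f a)
  p*c = trans (sym (ℚ.*-assoc p c (f a))) (trans (cong (_*ℚ f a) (ℚ.*-comm p c)) (ℚ.*-assoc c p (f a)))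

Pr-𝔼 : ∀ (d : Dist A) {P : Pred A 0ℓ} (P? : Decidable P) → Pr d P? ≡ 𝔼 d (λ a → ↑ 𝟙 (P? a))
Pr-𝔼 []            P? = refl
Pr-𝔼 ((a , p) ∷ d) P? with P? a
... | yes _ = cong₂ _+ℚ_ (sym (ℚ.*-identityʳ p)) (Pr-𝔼 d P?)
... | no _  = trans (Pr-𝔼 d P?) (sym (trans (cong (_+ℚ 𝔼 d (λ a → ↑ 𝟙 (P? a))) (ℚ.*-zeroʳ p)) (ℚ.+-identityˡ _)))

𝔼-fairCoins : ∀ n f → ↑ (2 ^ n) *ℚ 𝔼 (fairCoins n) (↑_ ∘ f) ≡ ↑ ∑ (vecs n) f
𝔼-fairCoins zero f = trans (ℚ.*-identityˡ _) (trans (𝔼-return [] (↑_ ∘ f)) (cong ↑_ (sym (∑-vecs-zero f))))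
𝔼-fairCoins (suc n) f = begin
  ↑ (2 ^ suc n) *ℚ 𝔼 (fairCoins (suc n)) (↑_ ∘ f)
    ≡⟨ cong₂ _*ℚ_ (trans (↑-* 2 (2 ^ n)) (ℚ.*-comm (↑ 2) (↑ (2 ^ n)))) (trans
         (𝔼->>= fairCoin (λ b → fairCoins n >>= λ bs → return (b ∷ bs)) (↑_ ∘ f))
         (𝔼-cong fairCoin λ b → trans (𝔼->>= (fairCoins n) (λ bs → return (b ∷ bs)) (↑_ ∘ f))
           (𝔼-cong (fairCoins n) λ bs → 𝔼-return (b ∷ bs) (↑_ ∘ f)))) ⟩
  ↑ (2 ^ n) *ℚ ↑ 2 *ℚ (½ *ℚ e true +ℚ (½ *ℚ e false +ℚ 0ℚ))
    ≡⟨ trans (ℚ.*-assoc (↑ (2 ^ n)) (↑ 2) _) (cong (↑ (2 ^ n) *ℚ_) (begin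
         ↑ 2 *ℚ (½ *ℚ e true +ℚ (½ *ℚ e false +ℚ 0ℚ))
           ≡⟨ cong (λ z → ↑ 2 *ℚ (½ *ℚ e true +ℚ z)) (ℚ.+-identityʳ (½ *ℚ e false)) ⟩
         ↑ 2 *ℚ (½ *ℚ e true +ℚ ½ *ℚ e false)
           ≡⟨ cong (↑ 2 *ℚ_) (ℚ.*-distribˡ-+ ½ (e true) (e false)) ⟨
         ↑ 2 *ℚ (½ *ℚ (e true +ℚ e false))
           ≡⟨ ℚ.*-assoc (↑ 2) ½ (e true +ℚ e false) ⟨
         1ℚ *ℚ (e true +ℚ e false)
           ≡⟨ ℚ.*-identityˡ _ ⟩
         e true +ℚ e false ∎)) ⟩
  ↑ (2 ^ n) *ℚ (e true +ℚ e false)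
    ≡⟨ ℚ.*-distribˡ-+ (↑ (2 ^ n)) (e true) (e false) ⟩
  ↑ (2 ^ n) *ℚ e true +ℚ ↑ (2 ^ n) *ℚ e false
    ≡⟨ cong₂ _+ℚ_ (𝔼-fairCoins n (f ∘ (true ∷_))) (𝔼-fairCoins n (f ∘ (false ∷_))) ⟩
  ↑ ∑ (vecs n) (f ∘ (true ∷_)) +ℚ ↑ ∑ (vecs n) (f ∘ (false ∷_))
    ≡⟨ ↑-+ (∑ (vecs n) (f ∘ (true ∷_))) (∑ (vecs n) (f ∘ (false ∷_))) ⟨
  ↑ (∑ (vecs n) (f ∘ (true ∷_)) + ∑ (vecs n) (f ∘ (false ∷_)))
    ≡⟨ cong ↑_ (∑-vecs-suc n f) ⟨
  ↑ ∑ (vecs (suc n)) f ∎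
  where
  open ≡-Reasoning
  e : Bool → ℚ
  e b = 𝔼 (fairCoins n) (λ bs → ↑ f (b ∷ bs))

𝔼-fairPairBits : ∀ n f → ↑ graphCount n *ℚ 𝔼 (fairPairBits n) (↑_ ∘ f) ≡ ↑ ∑ (graphs n) f
𝔼-fairPairBits zero f = trans (ℚ.*-identityˡ _) (trans (𝔼-return [] (↑_ ∘ f)) (cong ↑_ (sym (∑-graphs-zero f))))
𝔼-fairPairBits (suc n) f = begin
  ↑ graphCount (suc n) *ℚ 𝔼 (fairPairBits (suc n)) (↑_ ∘ f)
    ≡⟨ cong₂ _*ℚ_ (↑-* (2 ^ n) (graphCount n)) (trans
         (𝔼->>= (fairCoins n) (λ r → fairPairBits n >>= λ rs → return (r ∷ rs)) (↑_ ∘ f))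
         (𝔼-cong (fairCoins n) λ r → trans (𝔼->>= (fairPairBits n) (λ rs → return (r ∷ rs)) (↑_ ∘ f))
           (𝔼-cong (fairPairBits n) λ rs → 𝔼-return (r ∷ rs) (↑_ ∘ f)))) ⟩
  ↑ (2 ^ n) *ℚ ↑ graphCount n *ℚ 𝔼 (fairCoins n) e
    ≡⟨ ℚ.*-assoc (↑ (2 ^ n)) _ _ ⟩
  ↑ (2 ^ n) *ℚ (↑ graphCount n *ℚ 𝔼 (fairCoins n) e)
    ≡⟨ cong (↑ (2 ^ n) *ℚ_) (𝔼-*ˡ (fairCoins n) (↑ graphCount n) e) ⟨
  ↑ (2 ^ n) *ℚ 𝔼 (fairCoins n) (λ r → ↑ graphCount n *ℚ e r)
    ≡⟨ cong (↑ (2 ^ n) *ℚ_) (𝔼-cong (fairCoins n) λ r → 𝔼-fairPairBits n (f ∘ (r ∷_))) ⟩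
  ↑ (2 ^ n) *ℚ 𝔼 (fairCoins n) (λ r → ↑ ∑ (graphs n) (f ∘ (r ∷_)))
    ≡⟨ 𝔼-fairCoins n (λ r → ∑ (graphs n) (f ∘ (r ∷_))) ⟩
  ↑ ∑ (vecs n) (λ r → ∑ (graphs n) (f ∘ (r ∷_)))
    ≡⟨ cong ↑_ (∑-graphs-∷ n f) ⟨
  ↑ ∑ (graphs (suc n)) f ∎
  where
  open ≡-Reasoning
  e : Vec Bool n → ℚ
  e r = 𝔼 (fairPairBits n) (λ rs → ↑ f (r ∷ rs))

Pr-G⟨n,½⟩ : ∀ n {P : Pred (SimpleGraph n) 0ℓ} (P? : Decidable P) →
  ↑ graphCount n *ℚ Pr G⟨ n ,½⟩ P? ≡ ↑ ∑ (graphs n) (λ G → 𝟙 (P? (toGraph G)))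
Pr-G⟨n,½⟩ n P? = trans
  (cong (↑ graphCount n *ℚ_) (trans (Pr-𝔼 G⟨ n ,½⟩ P?)
    (trans (𝔼->>= (fairPairBits n) (return ∘ toGraph) (λ G → ↑ 𝟙 (P? G)))
      (𝔼-cong (fairPairBits n) λ bs → 𝔼-return (toGraph bs) (λ G → ↑ 𝟙 (P? G))))))
  (𝔼-fairPairBits n (λ G → 𝟙 (P? (toGraph G))))

𝟙-¬? : ∀ {P : Set} (d : Dec P) → 𝟙 (¬? d) + 𝟙 d ≡ 1
𝟙-¬? (yes _) = refl
𝟙-¬? (no _)  = refl

1-Pr-G⟨n,½⟩ : ∀ n {P : Pred (SimpleGraph n) 0ℓ} (P? : Decidable P) →
  ↑ graphCount n *ℚ (1ℚ - Pr G⟨ n ,½⟩ P?) ≡ ↑ ∑ (graphs n) (λ G → 𝟙 (¬? (P? (toGraph G))))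
1-Pr-G⟨n,½⟩ n P? = begin
  T *ℚ (1ℚ - p)            ≡⟨ ℚ.*-distribˡ-+ T 1ℚ (- p) ⟩
  T *ℚ 1ℚ +ℚ T *ℚ - p        ≡⟨ cong₂ _+ℚ_ (ℚ.*-identityʳ T) (sym (ℚ.neg-distribʳ-* T p)) ⟩
  T - T *ℚ p               ≡⟨ cong₂ (λ x y → x - y) T≡ (Pr-G⟨n,½⟩ n P?) ⟩
  (↑ bad +ℚ ↑ good) - ↑ good  ≡⟨ ℚ.+-assoc (↑ bad) (↑ good) _ ⟩
  ↑ bad +ℚ (↑ good - ↑ good)  ≡⟨ cong (λ x → ↑ bad +ℚ x) (ℚ.+-inverseʳ (↑ good)) ⟩
  ↑ bad +ℚ 0ℚ               ≡⟨ ℚ.+-identityʳ _ ⟩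
  ↑ bad                    ∎
  where
  open ≡-Reasoning
  T = ↑ graphCount n
  p = Pr G⟨ n ,½⟩ P?
  bad = ∑ (graphs n) (λ G → 𝟙 (¬? (P? (toGraph G))))
  good = ∑ (graphs n) (λ G → 𝟙 (P? (toGraph G)))
  T≡ : T ≡ ↑ bad +ℚ ↑ good
  T≡ = trans (cong ↑_ {graphCount n} (sym (trans (sym (∑-+ (graphs n) (λ G → 𝟙 (¬? (P? (toGraph G)))) (λ G → 𝟙 (P? (toGraph G)))))
    (trans (∑-cong (graphs n) λ G → 𝟙-¬? (P? (toGraph G)))
      (trans (∑-graphs-const n 1) (*-identityʳ _)))))) (↑-+ bad good)

graphCount-positive : ∀ n → 1 ≤ graphCount n
graphCount-positive zero    = s≤s z≤n
graphCount-positive (suc n) = *-mono-≤ (m^n>0 2 n) (graphCount-positive n)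

binaryLength : ∀ n → 1 ≤ n → ∃[ L ] 2 ^ L ≤ n × n < 2 ^ suc L
binaryLength (suc zero) _ = 0 , s≤s z≤n , s≤s (s≤s z≤n)
binaryLength (suc n@(suc _)) _ with binaryLength n (s≤s z≤n)
... | L , lo , hi with suc n <? 2 ^ suc L
...   | yes p = L , ≤-trans lo (n≤1+n n) , p
...   | no ¬p = suc L , ≮⇒≥ ¬p , (begin-strict
    suc n                       ≤⟨ hi ⟩
    2 ^ suc L                   ≡⟨ *-identityˡ (2 ^ suc L) ⟨
    1 * 2 ^ suc L               <⟨ *-monoˡ-< (2 ^ suc L) ⦃ m^n≢0 2 (suc L) ⦄ {1} {2} (s≤s (s≤s z≤n)) ⟩
    2 ^ suc (suc L)             ∎)
    where open ≤-Reasoning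

quadratic≤exponential : ∀ l → let K = 3 + 3 * (11 + l) in 2 + (K + K * (2 + K)) ≤ 2 ^ (11 + l)
quadratic≤exponential zero = m≤m+n 1406 642
quadratic≤exponential (suc l) = begin
  2 + (K (suc l) + K (suc l) * (2 + K (suc l)))
    ≤⟨ m≤m+n _ (1172 + 207 * l + 9 * (l * l)) ⟩
  2 + (K (suc l) + K (suc l) * (2 + K (suc l))) + (1172 + 207 * l + 9 * (l * l))
    ≡⟨ rearrange l ⟩
  2 * (2 + (K l + K l * (2 + K l)))
    ≤⟨ *-monoʳ-≤ 2 (quadratic≤exponential l) ⟩
  2 ^ (11 + suc l) ∎
  where
  open ≤-Reasoning
  K : ℕ → ℕ
  K l = 3 + 3 * (11 + l)
  rearrange : ∀ l → 2 + ((3 + 3 * (12 + l)) + (3 + 3 * (12 + l)) * (2 + (3 + 3 * (12 + l)))) + (1172 + 207 * l + 9 * (l * l))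
    ≡ 2 * (2 + ((3 + 3 * (11 + l)) + (3 + 3 * (11 + l)) * (2 + (3 + 3 * (11 + l)))))
  rearrange = solve-∀

-- K = 3 (L + 1) is large enough for n³ ≤ 2^K and still has K² much smaller than n.
failures-*-≤′ : ∀ l p → let L = 11 + l; n = 3 + p in 2 ^ L ≤ n → n < 2 ^ suc L →
  failures n * n ≤ 2 * graphCount n
failures-*-≤′ l p lo hi = *-cancelʳ-≤ _ _ (N * N) (begin
  failures N * N * (N * N)    ≡⟨ *-assoc (failures N) N (N * N) ⟩
  failures N * (N * (N * N))  ≤⟨ *-monoʳ-≤ (failures N) N³≤ ⟩
  failures N * 2 ^ K          ≤⟨ failures-≤ K p 2≤p bound ⟩
  N * N * (2 * graphCount N)  ≡⟨ *-comm (N * N) (2 * graphCount N) ⟩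
  2 * graphCount N * (N * N)  ∎)
  where
  open ≤-Reasoning
  L = 11 + l
  N = 3 + p
  K = 3 + 3 * L
  W = 2 ^ suc L
  size : K + K * (2 + K) ≤ suc p
  size = s≤s⁻¹ (s≤s⁻¹ (≤-trans (quadratic≤exponential l) lo))
  2≤p : 2 ≤ p
  2≤p = s≤s⁻¹ (≤-trans (m≤m+n 3 (3 * L)) (≤-trans (m≤m+n K _) size))
  bound : KrylovBound K (suc p)
  bound = subst (KrylovBound K) (m+[n∸m]≡n (≤-trans (m≤m+n K _) size))
    (∑-krylovOrthogonal-𝟏 K (suc p ∸ K) (s≤s z≤n)
      (≤-trans (≤-reflexive (sym (m+n∸m≡n K (K * (2 + K))))) (∸-monoˡ-≤ K size)))
  K≡ : suc L + (suc L + suc L) ≡ K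
  K≡ = sum≡ L
    where
    sum≡ : ∀ L → suc L + (suc L + suc L) ≡ 3 + 3 * L
    sum≡ = solve-∀
  N³≤ : N * (N * N) ≤ 2 ^ K
  N³≤ = begin
    N * (N * N)                        ≤⟨ *-mono-≤ (<⇒≤ hi) (*-mono-≤ (<⇒≤ hi) (<⇒≤ hi)) ⟩
    W * (W * W)                        ≡⟨ cong (W *_) (^-distribˡ-+-* 2 (suc L) (suc L)) ⟨
    W * 2 ^ (suc L + suc L)            ≡⟨ ^-distribˡ-+-* 2 (suc L) (suc L + suc L) ⟨
    2 ^ (suc L + (suc L + suc L))      ≡⟨ cong (2 ^_) K≡ ⟩
    2 ^ K                              ∎

failures-*-≤ : ∀ n → 2 ^ 11 ≤ n → failures n * n ≤ 2 * graphCount n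
failures-*-≤ n big = fromLength (binaryLength n (≤-trans (m^n>0 2 11) big))
  where
  3≤n : 3 ≤ n
  3≤n = ≤-trans (m≤m+n 3 2045) big
  fromLength : ∃[ L ] 2 ^ L ≤ n × n < 2 ^ suc L → failures n * n ≤ 2 * graphCount n
  fromLength (L , lo , hi) = subst (λ n → failures n * n ≤ 2 * graphCount n) n≡
    (failures-*-≤′ (L ∸ 11) (n ∸ 3)
      (subst₂ _≤_ (cong (2 ^_) (sym L≡)) (sym n≡) lo)
      (subst₂ _<_ (sym n≡) (cong (λ L → 2 ^ suc L) (sym L≡)) hi))
    where
    11≤L : 11 ≤ L
    11≤L = ≮⇒≥ λ L<11 → <-irrefl refl (<-≤-trans hi (≤-trans (^-monoʳ-≤ 2 {suc L} {11} L<11) big))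
    L≡ : 11 + (L ∸ 11) ≡ L
    L≡ = m+[n∸m]≡n 11≤L
    n≡ : 3 + (n ∸ 3) ≡ n
    n≡ = m+[n∸m]≡n 3≤n

↑-positive : ∀ {n} → 1 ≤ n → Positive (↑ n)
↑-positive {suc n} _ = ℚ.normalize-pos (suc n) 1

corollary4p2 : O[n^-½] (λ n → 1ℚ - Pr G⟨ n ,½⟩ noCospectralPair?)
corollary4p2 = ↑ 2 , ↑-mono {0} {2} z≤n , 2 ^ 11 , bound
  where
  bound : ∀ n → 2 ^ 11 ≤ n →
    (1ℚ - Pr G⟨ n ,½⟩ noCospectralPair?) *ℚ (1ℚ - Pr G⟨ n ,½⟩ noCospectralPair?) *ℚ ↑ n ≤ℚ ↑ 2 *ℚ ↑ 2
  bound n big = ℚ.*-cancelˡ-≤-pos T² ⦃ T²>0 ⦄ (begin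
    T² *ℚ (q *ℚ q *ℚ ↑ n)
      ≡⟨ cong (_*ℚ (q *ℚ q *ℚ ↑ n)) (↑-* t t) ⟩
    T *ℚ T *ℚ (q *ℚ q *ℚ ↑ n)
      ≡⟨ ℚ.*-assoc (T *ℚ T) (q *ℚ q) (↑ n) ⟨
    T *ℚ T *ℚ (q *ℚ q) *ℚ ↑ n
      ≡⟨ cong (_*ℚ ↑ n) (*ℚ-interchange T T q q) ⟩
    (T *ℚ q) *ℚ (T *ℚ q) *ℚ ↑ n
      ≡⟨ cong (λ x → x *ℚ x *ℚ ↑ n) (1-Pr-G⟨n,½⟩ n noCospectralPair?) ⟩
    ↑ F *ℚ ↑ F *ℚ ↑ n
      ≡⟨ trans (↑-* (F * F) n) (cong (_*ℚ ↑ n) (↑-* F F)) ⟨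
    ↑ (F * F * n)
      ≤⟨ ↑-mono F²n≤ ⟩
    ↑ (t * t * (2 * 2))
      ≡⟨ ↑-* (t * t) (2 * 2) ⟩
    T² *ℚ (↑ 2 *ℚ ↑ 2) ∎)
    where
    open ℚ.≤-Reasoning
    t = graphCount n
    T = ↑ t
    T² = ↑ (t * t)
    q = 1ℚ - Pr G⟨ n ,½⟩ noCospectralPair?
    F = failures n
    T²>0 : Positive T²
    T²>0 = ↑-positive (*-mono-≤ (graphCount-positive n) (graphCount-positive n))
    rearrange₁ : ∀ a b → a * a * (b * b) ≡ a * b * (a * b)
    rearrange₁ = solve-∀
    rearrange₂ : ∀ a → 2 * a * (2 * a) ≡ a * a * (2 * 2)
    rearrange₂ = solve-∀
    F²n≤ : F * F * n ≤ t * t * (2 * 2)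
    F²n≤ =
      ≤-trans (*-monoʳ-≤ (F * F) (m≤m*n n n ⦃ >-nonZero (≤-trans (m^n>0 2 11) big) ⦄))
      (≤-trans (≤-reflexive (rearrange₁ F n))
      (≤-trans (*-mono-≤ (failures-*-≤ n big) (failures-*-≤ n big))
               (≤-reflexive (rearrange₂ t))))
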